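{- Let $k\ge 2$ and $j\ge k+1$ be integers, and let $(G_t)_{t\ge j}$ be the random graph process started from the complete graph $G_j=K_j$ on vertices $v_1,\dots,v_j$, in which $G_{t}$ is obtained from $G_{t-1}$ by adding a vertex $v_t$ that is joined to a vertex $w$ of $G_{t-1}$ chosen with probability proportional to degree, and to $k-1$ distinct neighbours of $w$ in $G_{t-1}$ chosen uniformly at random. Let $d_n(v_i)$ be the degree of $v_i$ in $G_n$ and put $R=\frac{j(j-1)}{2k}$. (1) For every $1\le i\le j$, every $n\ge j$ and every integer $0\le x\le n-j$, $$ \mathbf{P}\left(d_n(v_i)=j-1+x\right)=\binom{x+j-2}{x}\sum_{u=0}^{x}(-1)^u\binom{x}{u}\,\frac{\left[n-j+\frac{(j-1)(j-k)-ku}{2k}-1\right]_{n-j}}{\left[n-j+R-1\right]_{n-j}} . $$ (2) For every $i>j$, every $n\ge i$ and every integer $0\le x\le n-i$, $$ \mathbf{P}\left(d_n(v_i)=k+x\right)=\binom{x+k-1}{x}\sum_{u=0}^{x}(-1)^u\binom{x}{u}\,\frac{\left[n-j+R-\frac{u+k}{2}-1\right]_{n-i}}{\left[n-j+R-1\right]_{n-i}} . $$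
   Context: For a real number $y$ and an integer $m\ge 0$, $[y]_m=y(y-1)\cdots(y-m+1)$ denotes the falling factorial, with $[y]_0=1$. The process: $G_j=K_j$ has vertex set $\{v_1,\dots,v_j\}$. For $t>j$, given $G_{t-1}$ (a simple graph on $\{v_1,\dots,v_{t-1}\}$), first a vertex $w$ of $G_{t-1}$ is chosen with probability $d_{t-1}(w)/\sum_{l=1}^{t-1}d_{t-1}(v_l)$, where $d_{t-1}(\cdot)$ denotes degree in $G_{t-1}$; then a set of $k-1$ distinct neighbours of $w$ in $G_{t-1}$ is chosen uniformly at random among all such sets. The new vertex $v_t$ is joined by one edge to $w$ and by one edge to each of the $k-1$ chosen neighbours. Thus each new vertex has degree $k$ when it is added, and $G_t$ has $t$ vertices and $\frac{j(j-1)}{2}+(t-j)k$ edges. -}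

module Defs where

open import Data.Bool using (Bool; true; false; not)
open import Data.Fin using (Fin; fromℕ<)
import Data.Fin as Fin
import Data.Fin.Properties as Fin
open import Data.Fin.Relation.Unary.Top using (View; view; ‵fromℕ; ‵inject₁)
open import Data.Fin.Subset using (Subset; inside; outside; ⁅_⁆; _∪_; ∣_∣)
open import Data.Fin.Subset.Properties using (_⊆?_)
open import Data.Integer using (+_)
import Data.Integer as ℤ
import Data.Integer.Properties as ℤ
open import Data.List using (List; []; _∷_; _++_; map; concatMap; filter; foldr; allFin)
open import Data.Nat using (ℕ; zero; suc; NonZero; _≤_; _∸_; _≤′_; ≤′-refl; ≤′-step; s≤s)
import Data.Nat as ℕ
import Data.Nat.Properties as ℕ
open import Data.Nat.ListAction using (sum)
open import Data.Product using (_×_; _,_; proj₁; proj₂)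
open import Data.Rational using (ℚ; 0ℚ; 1ℚ; _+_; _*_; _-_; _/_; Positive)
import Data.Rational as ℚ
import Data.Rational.Properties as ℚ
import Data.Rational.Unnormalised as ℚᵘ
import Data.Rational.Unnormalised.Properties as ℚᵘ
open import Data.Rational.Literals using (fromℤ)
open import Data.Rational.Solver using (module +-*-Solver)
open import Data.Vec using ([]; _∷_; tabulate; lookup)
open import Function using (const)
open import Relation.Binary.PropositionalEquality
  using (_≡_; refl; sym; trans; cong; cong₂; subst)
open import Relation.Nullary using (yes; no; does; contradiction)
open import Relation.Nullary.Decidable using (_×-dec_)
open import Relation.Unary using (Decidable)

-- A list of outcomes with their probabilities. The same outcome may be
-- listed several times; its probability is then the sum of the entries.
Dist : Set → Set
Dist A = List (A × ℚ)

private
  variable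
    A B : Set

-- The zero case only makes `proportional` total; see `step`.
ratio : ℕ → ℕ → ℚ
ratio a zero    = 0ℚ
ratio a (suc b) = + a / suc b

proportional : (A → ℕ) → List A → Dist A
proportional weight xs =
  map (λ x → x , ratio (weight x) (sum (map weight xs))) xs

uniform : List A → Dist A
uniform = proportional (const 1)

return : A → Dist A
return x = (x , 1ℚ) ∷ []

infixl 1 _>>=_
_>>=_ : Dist A → (A → Dist B) → Dist B
D >>= f = concatMap (λ (x , p) → map (λ (y , q) → y , p * q) (f x)) D

ℙ : {P : A → Set} → Dist A → Decidable P → ℚ
ℙ D P? = foldr _+_ 0ℚ (map proj₂ (filter (λ xp → P? (proj₁ xp)) D))

record Graph (n : ℕ) : Set where
  field
    adj        : Fin n → Fin n → Bool
    adj-sym    : ∀ x y → adj x y ≡ adj y x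
    adj-irrefl : ∀ x → adj x x ≡ false

open Graph public

-- Vertices are numbered from 1 in the mathematics and from 0 in `Fin`.
v : ∀ {n} i → 1 ≤ i → i ≤ n → Fin n
v (suc i) _ i<n = fromℕ< i<n

neighbours : ∀ {n} → Graph n → Fin n → Subset n
neighbours G w = tabulate (adj G w)

degree : ∀ {n} → Graph n → Fin n → ℕ
degree G w = ∣ neighbours G w ∣

complete : ∀ n → Graph n
complete n = record { adj = a ; adj-sym = a-sym ; adj-irrefl = a-irrefl }
  where
  a : Fin n → Fin n → Bool
  a x y = not (does (x Fin.≟ y))

  a-sym : ∀ x y → a x y ≡ a y x
  a-sym x y with x Fin.≟ y | y Fin.≟ x
  ... | yes _   | yes _   = refl
  ... | no _    | no _    = refl
  ... | yes x≡y | no y≢x  = contradiction (sym x≡y) y≢x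
  ... | no x≢y  | yes y≡x = contradiction (sym y≡x) x≢y

  a-irrefl : ∀ x → a x x ≡ false
  a-irrefl x with x Fin.≟ x
  ... | yes _  = refl
  ... | no x≢x = contradiction refl x≢x

-- The old vertices keep their indices and the new vertex is the last one.
addVertex : ∀ {n} → Graph n → Subset n → Graph (suc n)
addVertex {n} G S = record
  { adj        = λ x y → a (view x) (view y)
  ; adj-sym    = λ x y → a-sym (view x) (view y)
  ; adj-irrefl = λ x → a-irrefl (view x)
  }
  where
  a : ∀ {x y : Fin (suc n)} → View x → View y → Bool
  a (‵inject₁ i) (‵inject₁ j) = adj G i j
  a (‵inject₁ i) ‵fromℕ       = lookup S i
  a ‵fromℕ       (‵inject₁ j) = lookup S j
  a ‵fromℕ       ‵fromℕ       = false

  a-sym : ∀ {x y : Fin (suc n)} (p : View x) (q : View y) → a p q ≡ a q p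
  a-sym (‵inject₁ i) (‵inject₁ j) = adj-sym G i j
  a-sym (‵inject₁ i) ‵fromℕ       = refl
  a-sym ‵fromℕ       (‵inject₁ j) = refl
  a-sym ‵fromℕ       ‵fromℕ       = refl

  a-irrefl : ∀ {x : Fin (suc n)} (p : View x) → a p p ≡ false
  a-irrefl (‵inject₁ i) = adj-irrefl G i
  a-irrefl ‵fromℕ       = refl

allSubsets : ∀ n → List (Subset n)
allSubsets zero    = [] ∷ []
allSubsets (suc n) =
  map (inside ∷_) (allSubsets n) ++ map (outside ∷_) (allSubsets n)

subsetsOfSize : ∀ {n} → ℕ → Subset n → List (Subset n)
subsetsOfSize {n} m N =
  filter (λ S → (S ⊆? N) ×-dec (∣ S ∣ ℕ.≟ m)) (allSubsets n)

-- In the graphs that occur (started from K_j with j ≥ k + 1 and k ≥ 2)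
-- every degree is at least k, so the total degree is positive and w has
-- sets of k - 1 neighbours: both choices are over a positive total weight.
step : ∀ {n} → ℕ → Graph n → Dist (Graph (suc n))
step {n} k G =
  proportional (degree G) (allFin n) >>= λ w →
  uniform (subsetsOfSize (k ∸ 1) (neighbours G w)) >>= λ S →
  return (addVertex G (⁅ w ⁆ ∪ S))

-- The distribution of Gₙ, for n ≥ j, when Gⱼ = Kⱼ.
process : ∀ k {j n} → j ≤′ n → Dist (Graph n)
process k {j} ≤′-refl    = return (complete j)
process k (≤′-step j≤′n) = process k j≤′n >>= step k

ι : ℕ → ℚ
ι m = fromℤ (+ m)

infix 8 [_]↓_
[_]↓_ : ℚ → ℕ → ℚ
[ y ]↓ zero  = 1ℚ
[ y ]↓ suc m = y * [ y - 1ℚ ]↓ m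

infix 8 ∑≤
∑≤ : ℕ → (ℕ → ℚ) → ℚ
∑≤ zero    f = f 0
∑≤ (suc x) f = ∑≤ x f + f (suc x)

syntax ∑≤ x (λ u → e) = ∑[ u ≤ x ] e

2k≢0 : ∀ {k} → 2 ≤ k → NonZero (2 ℕ.* k)
2k≢0 (s≤s _) = _

R : ∀ k j → 2 ≤ k → ℚ
R k j 2≤k = (+ (j ℕ.* (j ∸ 1)) / (2 ℕ.* k)) {{2k≢0 2≤k}}

ι-+ : ∀ a b → ι (a ℕ.+ b) ≡ ι a + ι b
ι-+ a b = ℚ.toℚᵘ-injective
  (ℚᵘ.≃-trans (ℚᵘ.*≡* eq) (ℚᵘ.≃-sym (ℚ.toℚᵘ-homo-+ (ι a) (ι b))))
  where
  eq : + (a ℕ.+ b) ℤ.* + 1 ≡ (+ a ℤ.* + 1 ℤ.+ + b ℤ.* + 1) ℤ.* + 1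
  eq = cong (ℤ._* + 1)
    (sym (cong₂ ℤ._+_ (ℤ.*-identityʳ (+ a)) (ℤ.*-identityʳ (+ b))))

falling-positive : ∀ y m → Positive (y - ι m + 1ℚ) → Positive ([ y ]↓ m)
falling-positive y zero    _   = _
falling-positive y (suc m) pos =
  ℚ.pos*pos⇒pos y {{y-pos}} ([ y - 1ℚ ]↓ m)
    {{falling-positive (y - 1ℚ) m (subst Positive eq₁ pos)}}
  where
  open +-*-Solver
  eq₀ : y - ι (suc m) + 1ℚ ≡ y - ι m
  eq₀ = trans (cong (λ z → y - z + 1ℚ) (ι-+ 1 m))
    (solve 2 (λ y z → y :- (con 1ℚ :+ z) :+ con 1ℚ := y :- z) refl y (ι m))
  eq₁ : y - ι (suc m) + 1ℚ ≡ (y - 1ℚ) - ι m + 1ℚ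
  eq₁ = trans eq₀ (solve 2 (λ y z → y :- z := y :- con 1ℚ :- z :+ con 1ℚ) refl y (ι m))
  y-pos : Positive y
  y-pos = subst Positive
    (trans (cong (_+ ι m) eq₀) (solve 2 (λ y z → y :- z :+ z := y) refl y (ι m)))
    (ℚ.pos+nonNeg⇒pos (y - ι (suc m) + 1ℚ) {{pos}} (ι m))

R-positive : ∀ {k j} (2≤k : 2 ≤ k) → k ℕ.+ 1 ≤ j → Positive (R k j 2≤k)
R-positive {k} {j} 2≤k k<j = go 2≤k (ℕ.≤-trans (ℕ.+-monoˡ-≤ 1 2≤k) k<j)
  where
  go : ∀ {k j} (2≤k : 2 ≤ k) → 3 ≤ j → Positive (R k j 2≤k)
  go {k} {suc (suc j)} 2≤k (s≤s (s≤s _)) =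
    ℚ.normalize-pos (suc (suc j) ℕ.* suc j) (2 ℕ.* k) {{2k≢0 2≤k}}

-- The denominators [n - j + R - 1]_m with m ≤ n - j do not vanish.
denominator≢0 : ∀ {k j n m} (2≤k : 2 ≤ k) → k ℕ.+ 1 ≤ j → j ≤ n → m ≤ n ∸ j →
                ℚ.NonZero ([ ι n - ι j + R k j 2≤k - 1ℚ ]↓ m)
denominator≢0 {k} {j} {n} {m} 2≤k k<j j≤n m≤n∸j =
  ℚ.pos⇒nonZero ([ y ]↓ m) {{falling-positive y m (subst Positive (sym eq) pos)}}
  where
  open +-*-Solver
  r = R k j 2≤k
  y = ι n - ι j + r - 1ℚ
  d = n ∸ j ∸ m
  n≡ : n ≡ (d ℕ.+ m) ℕ.+ j
  n≡ = sym (trans (cong (ℕ._+ j) (ℕ.m∸n+n≡m m≤n∸j)) (ℕ.m∸n+n≡m j≤n))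
  eq : y - ι m + 1ℚ ≡ r + ι d
  eq = trans
    (cong (λ z → z - ι j + r - 1ℚ - ι m + 1ℚ)
      (trans (cong ι n≡) (trans (ι-+ (d ℕ.+ m) j) (cong (_+ ι j) (ι-+ d m)))))
    (solve 4 (λ d m j r → d :+ m :+ j :- j :+ r :- con 1ℚ :- m :+ con 1ℚ := r :+ d)
      refl (ι d) (ι m) (ι j) r)
  pos : Positive (r + ι d)
  pos = ℚ.pos+nonNeg⇒pos r {{R-positive 2≤k k<j}} (ι d)

{-# OPTIONS --safe #-}
module Submission where

-- Both formulas are one claim about a vertex whose degree at time i is a known d₀: i = j and d₀ =
-- j-1 for a vertex of K_j, d₀ = k at birth for a later one. The numerators of both are falling
-- factorials based on n-j+y-1 with y = R-(d₀+u)/2; in part (1) this is hidden in (j-1)(j-k)-ku =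
-- j(j-1)-k(j-1+u). From time n to n+1 a falling factorial gains one top factor, so the quotient is
-- multiplied by (n-j+y)/(n-j+R). Doubling top and bottom gives (τ-(d₀+u))/τ with τ = 2(n-j+R). The
-- constant R is forced: K_j has total degree j(j-1) = 2kR, and each step adds 2k. The total degree
-- is thus the same for all graphs that can occur at time n, so the transition probabilities of one
-- degree do not depend on the rest of the graph and its law has a closed recurrence. Recurrences
-- are kept multiplied by τ, and division happens only by cancelling a nonzero factor.

-- When the total degree of Gₙ is kτ, a vertex of degree d gains an edge in the
-- next step with probability d/τ, whatever the rest of the graph looks like.
-- So the law q of the degree satisfies τ q′(d+1) = (τ - (d+1)) q(d+1) + d q(d).
-- The alternating sums, for initial degree d₀ and x new edges, satisfy the same
-- recurrence: their u-th term is multiplied by (τ - (d₀+u))/τ at each step, and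
-- τ - (d₀+u) = (τ - (d₀+x)) + (x-u), where (x-u) C(x,u) = x C(x-1,u).
-- Initially they are the alternating row sums of Pascal's triangle.

open import Defs
open import Data.Bool using (Bool; true; false; _∧_; _∨_)
open import Data.Fin using (Fin; zero; suc; fromℕ; fromℕ<; inject₁)
import Data.Fin as Fin
import Data.Fin.Properties as Fin
open import Data.Fin.Relation.Unary.Top using (View; view; view-inject₁; view-fromℕ; ‵fromℕ; ‵inject₁)
open import Data.Fin.Subset using (Subset; inside; outside; ⁅_⁆; _∪_; ∣_∣; _⊆_)
open import Data.Fin.Subset.Properties using (_⊆?_; ∪-identityˡ; ∣p∣≤∣x∷p∣)
open import Data.Integer using (+_; -[1+_])
import Data.Integer as ℤ
import Data.Integer.Properties as ℤ
open import Data.List using (List; []; _∷_; _++_; map; filter; allFin)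
open import Data.List.Properties using (map-tabulate)
open import Data.List.Relation.Unary.All using (All; []; _∷_)
import Data.List.Relation.Unary.All as All
import Data.List.Relation.Unary.All.Properties as All
open import Data.Nat using (ℕ; zero; suc; NonZero; _≤_; _<_; _∸_; _≟_; s≤s; z≤n; s<s; z<s; _≤′_; ≤′-refl; ≤′-step)
import Data.Nat as ℕ
open import Data.Nat.Combinatorics using (_C_; nC1≡n; nCk+nC[k+1]≡[n+1]C[k+1]; k>n⇒nCk≡0)
open import Data.Nat.ListAction using (sum)
open import Data.Nat.Properties using (≤-refl; ≤-trans; <⇒≤; ≤⇒≤′; ∸-monoʳ-≤; m<n⇒0<n)
import Data.Nat.Properties as ℕ
open import Data.Product using (_×_; _,_; proj₁)
open import Data.Rational using (ℚ; 0ℚ; 1ℚ; _+_; _-_; _*_; -_; _/_; _÷_; Positive)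
import Data.Rational as ℚ
open import Data.Rational.Literals using (fromℤ)
import Data.Rational.Properties as ℚ
open import Data.Rational.Solver using (module +-*-Solver)
import Data.Rational.Unnormalised as ℚᵘ
import Data.Rational.Unnormalised.Properties as ℚᵘ
open import Data.Unit using (tt)
open import Data.Vec using ([]; _∷_; tabulate; lookup)
open import Data.Vec.Properties using (lookup∘tabulate; lookup-zipWith; lookup-replicate; []=⇒lookup; lookup⇒[]=)
open import Function using (const; id; _∘_)
open import Relation.Binary.PropositionalEquality
  using (_≡_; _≢_; refl; sym; trans; cong; cong₂; subst; module ≡-Reasoning)
open import Relation.Nullary using (Dec; yes; no; does; contradiction)
open import Relation.Nullary.Decidable using (dec-true; dec-false)
open import Relation.Unary using (Decidable)
open ≡-Reasoning

private
  variable
    Ω Ω′ : Set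
    n : ℕ

-- Arithmetic

-- Induction on `n`: Pascal's rule splits the left side into `a` and `b`. The hypothesis uses up
-- `suc k` copies of `a`, and the one copy left over raises the factor `suc n` to `suc (suc n)`.
absorption : ∀ n k → suc k ℕ.* (suc n C suc k) ≡ suc n ℕ.* (n C k)
absorption n zero = trans (ℕ.*-identityˡ _) (trans (nC1≡n (suc n)) (sym (ℕ.*-identityʳ _)))
absorption zero (suc k) =
  trans (cong (suc (suc k) ℕ.*_) (k>n⇒nCk≡0 {1} {suc (suc k)} (s<s z<s))) (ℕ.*-zeroʳ (suc (suc k)))
absorption (suc n) (suc k) = begin
  suc (suc k) ℕ.* (suc (suc n) C suc (suc k))
    ≡⟨ cong (suc (suc k) ℕ.*_) (nCk+nC[k+1]≡[n+1]C[k+1] (suc n) (suc k)) ⟨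
  suc (suc k) ℕ.* (a ℕ.+ b)
    ≡⟨ ℕ.*-distribˡ-+ (suc (suc k)) a b ⟩
  (a ℕ.+ suc k ℕ.* a) ℕ.+ suc (suc k) ℕ.* b
    ≡⟨ cong₂ (λ s t → (a ℕ.+ s) ℕ.+ t) (absorption n k) (absorption n (suc k)) ⟩
  (a ℕ.+ suc n ℕ.* (n C k)) ℕ.+ suc n ℕ.* (n C suc k)
    ≡⟨ ℕ.+-assoc a _ _ ⟩
  a ℕ.+ (suc n ℕ.* (n C k) ℕ.+ suc n ℕ.* (n C suc k))
    ≡⟨ cong (a ℕ.+_) (ℕ.*-distribˡ-+ (suc n) (n C k) (n C suc k)) ⟨
  a ℕ.+ suc n ℕ.* (n C k ℕ.+ n C suc k)
    ≡⟨ cong (λ s → a ℕ.+ suc n ℕ.* s) (nCk+nC[k+1]≡[n+1]C[k+1] n k) ⟩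
  suc (suc n) ℕ.* a ∎
  where
  a = suc n C suc k
  b = suc n C suc (suc k)

fromℤ-* : ∀ a b → fromℤ (a ℤ.* b) ≡ fromℤ a * fromℤ b
fromℤ-* a b = ℚ.toℚᵘ-injective (ℚᵘ.≃-sym (ℚ.toℚᵘ-homo-* (fromℤ a) (fromℤ b)))

fromℤ-+ : ∀ a b → fromℤ (a ℤ.+ b) ≡ fromℤ a + fromℤ b
fromℤ-+ a b = ℚ.toℚᵘ-injective
  (ℚᵘ.≃-trans
    (ℚᵘ.*≡* (cong (ℤ._* + 1) (sym (cong₂ ℤ._+_ (ℤ.*-identityʳ a) (ℤ.*-identityʳ b)))))
    (ℚᵘ.≃-sym (ℚ.toℚᵘ-homo-+ (fromℤ a) (fromℤ b))))

fromℤ-neg : ∀ a → fromℤ (ℤ.- a) ≡ - fromℤ a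
fromℤ-neg (+ zero)  = refl
fromℤ-neg (+ suc _) = refl
fromℤ-neg -[1+ _ ]  = refl

fromℤ-- : ∀ a b → fromℤ (a ℤ.- b) ≡ fromℤ a - fromℤ b
fromℤ-- a b = trans (fromℤ-+ a (ℤ.- b)) (cong (_+_ (fromℤ a)) (fromℤ-neg b))

ι-* : ∀ a b → ι (a ℕ.* b) ≡ ι a * ι b
ι-* a b = trans (cong fromℤ (ℤ.pos-* a b)) (fromℤ-* (+ a) (+ b))

ι-suc : ∀ a → ι (suc a) ≡ 1ℚ + ι a
ι-suc = ι-+ 1

-- Lets sets and edges be counted by rational sums and the result be read back in the natural
-- numbers.
ι-injective : ∀ {a b} → ι a ≡ ι b → a ≡ b
ι-injective refl = refl

ι-nonZero : ∀ a .{{_ : NonZero a}} → ℚ.NonZero (ι a)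
ι-nonZero (suc a) = _

/1≡fromℤ : ∀ z → z / 1 ≡ fromℤ z
/1≡fromℤ z = ℚ.fromℚᵘ-toℚᵘ (fromℤ z)

-- Since `_/_` reduces to lowest terms, the identity is checked on unnormalised fractions, where no
-- gcd occurs.
/-*-cancel : ∀ z d .{{_ : NonZero d}} → z / d * ι d ≡ fromℤ z
/-*-cancel z (suc d) = ℚ.toℚᵘ-injective
  (ℚᵘ.≃-trans (ℚ.toℚᵘ-homo-* (z / suc d) (ι (suc d)))
  (ℚᵘ.≃-trans (ℚᵘ.*-congʳ (ℚ.toℚᵘ-fromℚᵘ (ℚᵘ.mkℚᵘ z d)))
    (ℚᵘ.*≡* (ℤ.*-assoc z (+ suc d) (+ 1)))))

-- Sums with alternating binomial coefficients

sgn : ℕ → ℚ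
sgn zero    = 1ℚ
sgn (suc u) = - sgn u

-1^≡sgn : ∀ u → fromℤ (ℤ.-1ℤ ℤ.^ u) ≡ sgn u
-1^≡sgn zero    = refl
-1^≡sgn (suc u) = begin
  fromℤ (ℤ.-1ℤ ℤ.* ℤ.-1ℤ ℤ.^ u) ≡⟨ cong fromℤ (ℤ.-1*i≡-i _) ⟩
  fromℤ (ℤ.- ℤ.-1ℤ ℤ.^ u)       ≡⟨ fromℤ-neg _ ⟩
  - fromℤ (ℤ.-1ℤ ℤ.^ u)         ≡⟨ cong -_ (-1^≡sgn u) ⟩
  - sgn u                       ∎

signedC : ℕ → ℕ → ℚ
signedC x u = sgn u * ι (x C u)

/1≡signedC : ∀ x u → ((ℤ.-1ℤ ℤ.^ u) ℤ.* + (x C u)) / 1 ≡ signedC x u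
/1≡signedC x u = trans (/1≡fromℤ _)
  (trans (fromℤ-* (ℤ.-1ℤ ℤ.^ u) (+ (x C u))) (cong (_* ι (x C u)) (-1^≡sgn u)))

signedC-pascal : ∀ x u → signedC (suc x) (suc u) ≡ signedC x (suc u) - signedC x u
signedC-pascal x u = trans
  (cong (λ z → - sgn u * z)
    (trans (cong ι (sym (nCk+nC[k+1]≡[n+1]C[k+1] x u))) (ι-+ (x C u) (x C suc u))))
  (solve 3 (λ s a b → (:- s) :* (a :+ b) := (:- s) :* b :- s :* a) refl
    (sgn u) (ι (x C u)) (ι (x C suc u)))
  where open +-*-Solver

signedC-overflow : ∀ x → signedC x (suc x) ≡ 0ℚ
signedC-overflow x =
  trans (cong (λ z → sgn (suc x) * ι z) (k>n⇒nCk≡0 (ℕ.n<1+n x))) (ℚ.*-zeroʳ (sgn (suc x)))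

-- Absorption turns u C(x+1,u) into (x+1) C(x,u-1), and Pascal's rule then leaves (x+1) C(x,u). The
-- difference is taken in ℚ, so no bound on `u` is required.
signedC-absorption : ∀ x u →
  signedC (suc x) u * (ι (suc x) - ι u) ≡ ι (suc x) * signedC x u
signedC-absorption x zero = solve 1 (λ a → con 1ℚ :* con 1ℚ :* (a :- con 0ℚ) := a :* (con 1ℚ :* con 1ℚ))
  refl (ι (suc x))
  where open +-*-Solver
signedC-absorption x (suc u) = begin
  - s * c * (X - U)
    ≡⟨ solve 4 (λ s c X U → (:- s) :* c :* (X :- U) := (:- s) :* (X :* c :- U :* c)) refl s c X U ⟩
  - s * (X * c - U * c)         ≡⟨ cong (λ z → - s * (X * c - z)) U*c ⟩
  - s * (X * c - X * a)         ≡⟨ cong (λ z → - s * (X * z - X * a)) c≡ ⟩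
  - s * (X * (a + b) - X * a)
    ≡⟨ solve 4 (λ s X a b → (:- s) :* (X :* (a :+ b) :- X :* a) := X :* ((:- s) :* b)) refl s X a b ⟩
  X * (- s * b)                 ∎
  where
  open +-*-Solver
  s = sgn u
  X = ι (suc x)
  U = ι (suc u)
  a = ι (x C u)
  b = ι (x C suc u)
  c = ι (suc x C suc u)
  c≡ : c ≡ a + b
  c≡ = trans (cong ι (sym (nCk+nC[k+1]≡[n+1]C[k+1] x u))) (ι-+ (x C u) (x C suc u))
  U*c : U * c ≡ X * a
  U*c = trans (sym (ι-* (suc u) (suc x C suc u))) (trans (cong ι (absorption x u)) (ι-* (suc x) (x C u)))

∑≤-cong : ∀ x {f g : ℕ → ℚ} → (∀ u → f u ≡ g u) → ∑≤ x f ≡ ∑≤ x g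
∑≤-cong zero    f≡g = f≡g 0
∑≤-cong (suc x) f≡g = cong₂ _+_ (∑≤-cong x f≡g) (f≡g (suc x))

∑≤-+ : ∀ x (f g : ℕ → ℚ) → ∑≤ x (λ u → f u + g u) ≡ ∑≤ x f + ∑≤ x g
∑≤-+ zero    f g = refl
∑≤-+ (suc x) f g = trans (cong (_+ (f (suc x) + g (suc x))) (∑≤-+ x f g))
  (solve 4 (λ a b c d → (a :+ b) :+ (c :+ d) := (a :+ c) :+ (b :+ d)) refl
    (∑≤ x f) (∑≤ x g) (f (suc x)) (g (suc x)))
  where open +-*-Solver

∑≤-*ʳ : ∀ x (f : ℕ → ℚ) c → ∑≤ x (λ u → f u * c) ≡ ∑≤ x f * c
∑≤-*ʳ zero    f c = refl
∑≤-*ʳ (suc x) f c =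
  trans (cong (_+ f (suc x) * c) (∑≤-*ʳ x f c)) (sym (ℚ.*-distribʳ-+ c (∑≤ x f) (f (suc x))))

-- By Pascal's rule the alternating row sums telescope.
∑-signedC-partial : ∀ x m → ∑≤ m (signedC (suc x)) ≡ signedC x m
∑-signedC-partial x zero    = refl
∑-signedC-partial x (suc m) =
  trans (cong₂ _+_ (∑-signedC-partial x m) (signedC-pascal x m))
  (solve 2 (λ a b → a :+ (b :- a) := b) refl (signedC x m) (signedC x (suc m)))
  where open +-*-Solver

∑-signedC : ∀ x → ∑≤ (suc x) (signedC (suc x)) ≡ 0ℚ
∑-signedC x = trans (∑-signedC-partial x (suc x)) (signedC-overflow x)

-- `x` is the number of edges gained by a vertex of initial degree `suc e`.
closed : ℕ → (ℕ → ℚ) → ℕ → ℚ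
closed e A x = ι ((x ℕ.+ e) C x) * ∑≤ x (λ u → signedC x u * A u)

closed-init : ∀ e {A} → (∀ u → A u ≡ 1ℚ) → closed e A 0 ≡ 1ℚ
closed-init e A≡1 = cong (λ z → 1ℚ * (1ℚ * 1ℚ * z)) (A≡1 0)

closed-init-suc : ∀ e {A} → (∀ u → A u ≡ 1ℚ) → ∀ x → closed e A (suc x) ≡ 0ℚ
closed-init-suc e {A} A≡1 x = trans (cong (ι _ *_) (trans
  (∑≤-cong (suc x) λ u → trans (cong (signedC (suc x) u *_) (A≡1 u)) (ℚ.*-identityʳ _))
  (∑-signedC x))) (ℚ.*-zeroʳ (ι ((suc x ℕ.+ e) C suc x)))

-- One step of the recurrence for the alternating sums

module _ (e : ℕ) (τ : ℚ) (A A′ : ℕ → ℚ) (A-step : ∀ u → A′ u * τ ≡ A u * (τ - ι (suc (u ℕ.+ e)))) where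
  open +-*-Solver

  closed-step-zero : closed e A′ 0 * τ ≡ closed e A 0 * (τ - ι (suc e))
  closed-step-zero = begin
    1ℚ * (1ℚ * 1ℚ * A′ 0) * τ
      ≡⟨ solve 2 (λ a t → con 1ℚ :* (con 1ℚ :* con 1ℚ :* a) :* t := con 1ℚ :* (con 1ℚ :* con 1ℚ :* (a :* t))) refl
         (A′ 0) τ ⟩
    1ℚ * (1ℚ * 1ℚ * (A′ 0 * τ)) ≡⟨ cong (λ z → 1ℚ * (1ℚ * 1ℚ * z)) (A-step 0) ⟩
    1ℚ * (1ℚ * 1ℚ * (A 0 * (τ - ι (suc e))))
      ≡⟨ solve 2 (λ a t → con 1ℚ :* (con 1ℚ :* con 1ℚ :* a) :* t := con 1ℚ :* (con 1ℚ :* con 1ℚ :* (a :* t))) refl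
         (A 0) (τ - ι (suc e)) ⟨
    closed e A 0 * (τ - ι (suc e)) ∎

  closed-step-suc : ∀ x → closed e A′ (suc x) * τ ≡
    closed e A (suc x) * (τ - ι (suc (suc x ℕ.+ e))) + closed e A x * ι (suc (x ℕ.+ e))
  closed-step-suc x = begin
    B * ∑≤ (suc x) (λ u → c u * A′ u) * τ
      ≡⟨ trans (ℚ.*-assoc B (∑≤ (suc x) (λ u → c u * A′ u)) τ)
         (cong (B *_) (sym (∑≤-*ʳ (suc x) (λ u → c u * A′ u) τ))) ⟩
    B * ∑≤ (suc x) (λ u → c u * A′ u * τ)
      ≡⟨ cong (B *_) (∑≤-cong (suc x) termwise) ⟩
    B * ∑≤ (suc x) (λ u → c u * A u * T + signedC x u * A u * X)
      ≡⟨ cong (B *_) (trans (∑≤-+ (suc x) (λ u → c u * A u * T) (λ u → signedC x u * A u * X))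
         (cong₂ _+_ (∑≤-*ʳ (suc x) (λ u → c u * A u) T) (∑≤-*ʳ (suc x) (λ u → signedC x u * A u) X))) ⟩
    -- The sum over row `x` runs one index too far; its last coefficient is C(x, x+1) = 0.
    B * (S * T + (S₀ + signedC x (suc x) * A (suc x)) * X)
      ≡⟨ cong (λ z → B * (S * T + (S₀ + z * A (suc x)) * X)) (signedC-overflow x) ⟩
    B * (S * T + (S₀ + 0ℚ * A (suc x)) * X)
      ≡⟨ solve 6 (λ B S T S₀ X a → B :* (S :* T :+ (S₀ :+ con 0ℚ :* a) :* X) := B :* S :* T :+ (X :* B) :* S₀) refl B
         S T S₀ X (A (suc x)) ⟩
    B * S * T + (X * B) * S₀
      ≡⟨ cong (λ z → B * S * T + z * S₀) X*B ⟩
    B * S * T + (E * B₀) * S₀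
      ≡⟨ cong (_+_ (B * S * T)) (solve 3 (λ E B₀ S₀ → (E :* B₀) :* S₀ := B₀ :* S₀ :* E) refl E B₀ S₀) ⟩
    B * S * T + B₀ * S₀ * E ∎
    where
    c = signedC (suc x)
    B = ι ((suc x ℕ.+ e) C suc x)
    B₀ = ι ((x ℕ.+ e) C x)
    S = ∑≤ (suc x) (λ u → c u * A u)
    S₀ = ∑≤ x (λ u → signedC x u * A u)
    T = τ - ι (suc (suc x ℕ.+ e))
    X = ι (suc x)
    E = ι (suc (x ℕ.+ e))
    -- The factor x+1 freed by absorption inside the sum is spent on the outer binomial coefficient,
    -- where it becomes x+e+1, the degree from which the edge is gained.
    X*B : X * B ≡ E * B₀
    X*B = trans (sym (ι-* (suc x) _)) (trans (cong ι (absorption (x ℕ.+ e) x)) (ι-* (suc (x ℕ.+ e)) _))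
    termwise : ∀ u → c u * A′ u * τ ≡ c u * A u * T + signedC x u * A u * X
    termwise u = begin
      c u * A′ u * τ  ≡⟨ ℚ.*-assoc (c u) (A′ u) τ ⟩
      c u * (A′ u * τ) ≡⟨ cong (c u *_) (A-step u) ⟩
      c u * (A u * (τ - ι (suc (u ℕ.+ e))))
        ≡⟨ cong (λ z → c u * (A u * (τ - z))) (trans (ι-suc (u ℕ.+ e)) (cong (_+_ 1ℚ) (ι-+ u e))) ⟩
      c u * (A u * (τ - (1ℚ + (ι u + ι e))))
        ≡⟨ solve 6 (λ c a t u e X → c :* (a :* (t :- (con 1ℚ :+ (u :+ e)))) := c :* a :* (t :- (con 1ℚ :+ (X :+ e)))
           :+ c :* (X :- u) :* a)
             refl (c u) (A u) τ (ι u) (ι e) X ⟩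
      c u * A u * (τ - (1ℚ + (X + ι e))) + c u * (X - ι u) * A u
        ≡⟨ cong₂ (λ y z → c u * A u * (τ - y) + z * A u)
           (trans (cong (_+_ 1ℚ) (sym (ι-+ (suc x) e))) (sym (ι-suc (suc x ℕ.+ e)))) (signedC-absorption x u) ⟩
      c u * A u * T + X * signedC x u * A u
        ≡⟨ cong (_+_ (c u * A u * T)) (solve 3 (λ X s a → X :* s :* a := s :* a :* X) refl X (signedC x u) (A u)) ⟩
      c u * A u * T + signedC x u * A u * X ∎

-- One step of the evolution of the law of a degree, cleared of the denominator τ.
record Evolves (τ : ℚ) (q q′ : ℕ → ℚ) : Set where
  field
    evolves-zero : q′ 0 * τ ≡ q 0 * τ
    evolves-suc  : ∀ d → q′ (suc d) * τ ≡ q (suc d) * (τ - ι (suc d)) + q d * ι d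

-- The initial degree is `suc e`. The values below it are recorded too, because the recurrence for
-- degree `suc e` draws on `q e`.
record Law (e : ℕ) (A : ℕ → ℚ) (q : ℕ → ℚ) : Set where
  field
    vanishes : ∀ {d} → d ≤ e → q d ≡ 0ℚ
    agrees   : ∀ x → q (suc (x ℕ.+ e)) ≡ closed e A x

open Evolves
open Law

*-cancelʳ : ∀ {p q} r .{{_ : ℚ.NonZero r}} → p * r ≡ q * r → p ≡ q
*-cancelʳ {p} {q} r pr≡qr = begin
  p                  ≡⟨ ℚ.*-identityʳ p ⟨
  p * 1ℚ             ≡⟨ cong (p *_) (ℚ.*-inverseʳ r) ⟨
  p * (r * ℚ.1/ r)   ≡⟨ ℚ.*-assoc p r _ ⟨
  p * r * ℚ.1/ r     ≡⟨ cong (_* ℚ.1/ r) pr≡qr ⟩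
  q * r * ℚ.1/ r     ≡⟨ ℚ.*-assoc q r _ ⟩
  q * (r * ℚ.1/ r)   ≡⟨ cong (q *_) (ℚ.*-inverseʳ r) ⟩
  q * 1ℚ             ≡⟨ ℚ.*-identityʳ q ⟩
  q                  ∎

law-init : ∀ {e A q} → (∀ u → A u ≡ 1ℚ) → q (suc e) ≡ 1ℚ → (∀ {d} → d ≢ suc e → q d ≡ 0ℚ) → Law e A q
law-init {e} A≡1 q≡1 q≡0 .vanishes d≤e = q≡0 λ { refl → ℕ.<-irrefl refl d≤e }
law-init {e} A≡1 q≡1 q≡0 .agrees zero = trans q≡1 (sym (closed-init e A≡1))
law-init {e} A≡1 q≡1 q≡0 .agrees (suc x) =
  trans (q≡0 λ eq → ℕ.<-irrefl (sym eq) (s≤s (s≤s (ℕ.m≤n+m e x)))) (sym (closed-init-suc e A≡1 x))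

-- As `τ` is nonzero, the recurrence determines `q′` from `q`. It therefore suffices that zero below
-- the initial degree and `closed e A′` above it solve the same recurrence.
law-step : ∀ {e A A′ q q′} τ .{{_ : ℚ.NonZero τ}} →
  (∀ u → A′ u * τ ≡ A u * (τ - ι (suc (u ℕ.+ e)))) →
  Evolves τ q q′ → Law e A q → Law e A′ q′
law-step {e} {q = q} {q′} τ A-step ev law .vanishes {zero} _ =
  trans (*-cancelʳ τ (evolves-zero ev)) (vanishes law ℕ.z≤n)
law-step {e} {q = q} {q′} τ A-step ev law .vanishes {suc d} d<e = *-cancelʳ τ (begin
  q′ (suc d) * τ                            ≡⟨ evolves-suc ev d ⟩
  q (suc d) * (τ - ι (suc d)) + q d * ι d
    ≡⟨ cong₂ (λ y z → y * (τ - ι (suc d)) + z * ι d) (vanishes law d<e) (vanishes law (ℕ.<⇒≤ d<e)) ⟩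
  0ℚ * (τ - ι (suc d)) + 0ℚ * ι d
    ≡⟨ solve 2 (λ t i → con 0ℚ :* t :+ con 0ℚ :* i := con 0ℚ) refl (τ - ι (suc d)) (ι d) ⟩
  0ℚ                                        ≡⟨ ℚ.*-zeroˡ τ ⟨
  0ℚ * τ                                    ∎)
  where open +-*-Solver
law-step {e} {A} {A′} {q} {q′} τ A-step ev law .agrees zero = *-cancelʳ τ (begin
  q′ (suc e) * τ                            ≡⟨ evolves-suc ev e ⟩
  q (suc e) * (τ - ι (suc e)) + q e * ι e
    ≡⟨ cong₂ (λ y z → y * (τ - ι (suc e)) + z * ι e) (agrees law 0) (vanishes law ℕ.≤-refl) ⟩
  closed e A 0 * (τ - ι (suc e)) + 0ℚ * ι e
    ≡⟨ solve 2 (λ c i → c :+ con 0ℚ :* i := c) refl (closed e A 0 * (τ - ι (suc e))) (ι e) ⟩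
  closed e A 0 * (τ - ι (suc e))            ≡⟨ closed-step-zero e τ A A′ A-step ⟨
  closed e A′ 0 * τ                         ∎)
  where open +-*-Solver
law-step {e} {A} {A′} {q} {q′} τ A-step ev law .agrees (suc x) = *-cancelʳ τ
  (trans (evolves-suc ev (suc (x ℕ.+ e)))
  (trans (cong₂ (λ y z → y * (τ - ι (suc (suc x ℕ.+ e))) + z * ι (suc (x ℕ.+ e))) (agrees law (suc x)) (agrees law x))
    (sym (closed-step-suc e τ A A′ A-step x))))

-- Finite sums

𝟙 : Bool → ℚ
𝟙 true  = 1ℚ
𝟙 false = 0ℚ

∑ : (Ω → ℚ) → List Ω → ℚ
∑ f []       = 0ℚ
∑ f (x ∷ xs) = f x + ∑ f xs

∑-congAll : ∀ {f g : Ω → ℚ} {xs} → All (λ x → f x ≡ g x) xs → ∑ f xs ≡ ∑ g xs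
∑-congAll []             = refl
∑-congAll (fx≡gx ∷ rest) = cong₂ _+_ fx≡gx (∑-congAll rest)

∑-cong : ∀ {f g : Ω → ℚ} → (∀ x → f x ≡ g x) → ∀ xs → ∑ f xs ≡ ∑ g xs
∑-cong f≡g xs = ∑-congAll (All.universal f≡g xs)

∑-+ : ∀ (f g : Ω → ℚ) xs → ∑ (λ x → f x + g x) xs ≡ ∑ f xs + ∑ g xs
∑-+ f g []       = refl
∑-+ f g (x ∷ xs) = trans (cong (_+_ (f x + g x)) (∑-+ f g xs))
  (solve 4 (λ a b c d → (a :+ b) :+ (c :+ d) := (a :+ c) :+ (b :+ d)) refl
    (f x) (g x) (∑ f xs) (∑ g xs))
  where open +-*-Solver

∑-*ˡ : ∀ c (f : Ω → ℚ) xs → ∑ (λ x → c * f x) xs ≡ c * ∑ f xs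
∑-*ˡ c f []       = sym (ℚ.*-zeroʳ c)
∑-*ˡ c f (x ∷ xs) = trans (cong (_+_ (c * f x)) (∑-*ˡ c f xs)) (sym (ℚ.*-distribˡ-+ c (f x) (∑ f xs)))

∑-*ʳ : ∀ c (f : Ω → ℚ) xs → ∑ (λ x → f x * c) xs ≡ ∑ f xs * c
∑-*ʳ c f xs = trans (∑-cong (λ x → ℚ.*-comm (f x) c) xs) (trans (∑-*ˡ c f xs) (ℚ.*-comm c (∑ f xs)))

∑-++ : ∀ (f : Ω → ℚ) xs ys → ∑ f (xs ++ ys) ≡ ∑ f xs + ∑ f ys
∑-++ f []       ys = sym (ℚ.+-identityˡ _)
∑-++ f (x ∷ xs) ys = trans (cong (_+_ (f x)) (∑-++ f xs ys)) (sym (ℚ.+-assoc (f x) _ _))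

∑-map : ∀ (f : Ω′ → ℚ) (g : Ω → Ω′) xs → ∑ f (map g xs) ≡ ∑ (f ∘ g) xs
∑-map f g []       = refl
∑-map f g (x ∷ xs) = cong (_+_ (f (g x))) (∑-map f g xs)

∑-zero : ∀ (xs : List Ω) → ∑ (const 0ℚ) xs ≡ 0ℚ
∑-zero []       = refl
∑-zero (x ∷ xs) = trans (ℚ.+-identityˡ _) (∑-zero xs)

∑-filter : ∀ {P : Ω → Set} (P? : Decidable P) (f : Ω → ℚ) xs →
           ∑ f (filter P? xs) ≡ ∑ (λ x → 𝟙 (does (P? x)) * f x) xs
∑-filter P? f [] = refl
∑-filter P? f (x ∷ xs) with does (P? x)
... | true  = cong₂ _+_ (sym (ℚ.*-identityˡ (f x))) (∑-filter P? f xs)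
... | false = trans (∑-filter P? f xs)
  (trans (sym (ℚ.+-identityˡ _)) (cong (_+ ∑ _ xs) (sym (ℚ.*-zeroˡ (f x)))))

ι-sum : ∀ (f : Ω → ℕ) xs → ι (sum (map f xs)) ≡ ∑ (ι ∘ f) xs
ι-sum f []       = refl
ι-sum f (x ∷ xs) = trans (ι-+ (f x) _) (cong (_+_ (ι (f x))) (ι-sum f xs))

∑-allFin-suc : ∀ n (f : Fin (suc n) → ℚ) →
               ∑ f (allFin (suc n)) ≡ f zero + ∑ (f ∘ suc) (allFin n)
∑-allFin-suc n f = cong (_+_ (f zero))
  (trans (cong (∑ f) (sym (map-tabulate id suc))) (∑-map f suc (allFin n)))

∑-allFin-last : ∀ n (f : Fin (suc n) → ℚ) →
                ∑ f (allFin (suc n)) ≡ ∑ (f ∘ inject₁) (allFin n) + f (fromℕ n)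
∑-allFin-last zero    f = ℚ.+-comm (f zero) 0ℚ
∑-allFin-last (suc n) f = begin
  ∑ f (allFin (suc (suc n)))                                   ≡⟨ ∑-allFin-suc (suc n) f ⟩
  f zero + ∑ (f ∘ suc) (allFin (suc n))
    ≡⟨ cong (_+_ (f zero)) (∑-allFin-last n (f ∘ suc)) ⟩
  f zero + (∑ (f ∘ suc ∘ inject₁) (allFin n) + f (fromℕ (suc n))) ≡⟨ ℚ.+-assoc (f zero) _ _ ⟨
  f zero + ∑ (f ∘ inject₁ ∘ suc) (allFin n) + f (fromℕ (suc n))
    ≡⟨ cong (_+ f (fromℕ (suc n))) (∑-allFin-suc n (f ∘ inject₁)) ⟨
  ∑ (f ∘ inject₁) (allFin (suc n)) + f (fromℕ (suc n))         ∎

∑-const : ∀ n c → ∑ (const c) (allFin n) ≡ ι n * c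
∑-const zero    c = sym (ℚ.*-zeroˡ c)
∑-const (suc n) c = begin
  ∑ (const c) (allFin (suc n)) ≡⟨ ∑-allFin-suc n (const c) ⟩
  c + ∑ (const c) (allFin n)   ≡⟨ cong (_+_ c) (∑-const n c) ⟩
  c + ι n * c                  ≡⟨ solve 2 (λ c n → c :+ n :* c := (con 1ℚ :+ n) :* c) refl c (ι n) ⟩
  (1ℚ + ι n) * c               ≡⟨ cong (_* c) (ι-suc n) ⟨
  ι (suc n) * c                ∎
  where open +-*-Solver

∑-δ : ∀ (v : Fin n) c → ∑ (λ w → 𝟙 (does (w Fin.≟ v)) * c) (allFin n) ≡ c
∑-δ {suc n} zero c = begin
  ∑ (λ w → 𝟙 (does (w Fin.≟ zero)) * c) (allFin (suc n))
    ≡⟨ ∑-allFin-suc n (λ w → 𝟙 (does (w Fin.≟ zero)) * c) ⟩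
  1ℚ * c + ∑ (λ _ → 0ℚ * c) (allFin n)
    ≡⟨ cong₂ _+_ (ℚ.*-identityˡ c) (trans (∑-cong (λ _ → ℚ.*-zeroˡ c) (allFin n)) (∑-zero (allFin n))) ⟩
  c + 0ℚ ≡⟨ ℚ.+-identityʳ c ⟩
  c ∎
∑-δ {suc n} (suc v) c = begin
  ∑ (λ w → 𝟙 (does (w Fin.≟ suc v)) * c) (allFin (suc n))
    ≡⟨ ∑-allFin-suc n (λ w → 𝟙 (does (w Fin.≟ suc v)) * c) ⟩
  0ℚ * c + ∑ (λ w → 𝟙 (does (w Fin.≟ v)) * c) (allFin n) ≡⟨ cong₂ _+_ (ℚ.*-zeroˡ c) (∑-δ v c) ⟩
  0ℚ + c ≡⟨ ℚ.+-identityˡ c ⟩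
  c ∎

-- Expectations

𝔼 : Dist Ω → (Ω → ℚ) → ℚ
𝔼 D f = ∑ (λ (x , p) → p * f x) D

-- Every listed outcome counts, even one listed with probability 0. This is stronger than almost
-- sure and passes through `>>=` without looking at the probabilities.
Almost : (Ω → Set) → Dist Ω → Set
Almost P = All (P ∘ proj₁)

ℙ≡𝔼 : ∀ {P : Ω → Set} (D : Dist Ω) (P? : Decidable P) → ℙ D P? ≡ 𝔼 D (λ x → 𝟙 (does (P? x)))
ℙ≡𝔼 []            P? = refl
ℙ≡𝔼 ((x , p) ∷ D) P? with does (P? x)
... | true  = cong₂ _+_ (sym (ℚ.*-identityʳ p)) (ℙ≡𝔼 D P?)
... | false = trans (ℙ≡𝔼 D P?) (trans (sym (ℚ.+-identityˡ _)) (cong (_+ 𝔼 D _) (sym (ℚ.*-zeroʳ p))))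

𝔼-cong : ∀ {P : Ω → Set} {D : Dist Ω} {f g} → Almost P D → (∀ {x} → P x → f x ≡ g x) → 𝔼 D f ≡ 𝔼 D g
𝔼-cong PD f≡g = ∑-congAll (All.map (λ {(x , p)} Px → cong (p *_) (f≡g Px)) PD)

𝔼-*ʳ : ∀ (D : Dist Ω) f c → 𝔼 D (λ x → f x * c) ≡ 𝔼 D f * c
𝔼-*ʳ D f c = trans (∑-cong (λ (x , p) → sym (ℚ.*-assoc p (f x) c)) D) (∑-*ʳ c _ D)

𝔼-+ : ∀ (D : Dist Ω) f g → 𝔼 D (λ x → f x + g x) ≡ 𝔼 D f + 𝔼 D g
𝔼-+ D f g = trans (∑-cong (λ (x , p) → ℚ.*-distribˡ-+ p (f x) (g x)) D) (∑-+ _ _ D)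

𝔼-const : ∀ (D : Dist Ω) c → 𝔼 D (const 1ℚ) ≡ 1ℚ → 𝔼 D (const c) ≡ c
𝔼-const D c D1 = begin
  𝔼 D (const c)             ≡⟨ ∑-cong (λ (x , p) → cong (p *_) (sym (ℚ.*-identityˡ c))) D ⟩
  𝔼 D (λ _ → 1ℚ * c)        ≡⟨ 𝔼-*ʳ D (const 1ℚ) c ⟩
  𝔼 D (const 1ℚ) * c        ≡⟨ cong (_* c) D1 ⟩
  1ℚ * c                    ≡⟨ ℚ.*-identityˡ c ⟩
  c                         ∎

𝔼-return : ∀ (x : Ω) f → 𝔼 (return x) f ≡ f x
𝔼-return x f = trans (ℚ.+-identityʳ _) (ℚ.*-identityˡ (f x))

𝔼-bind : ∀ (D : Dist Ω) (F : Ω → Dist Ω′) g → 𝔼 (D >>= F) g ≡ 𝔼 D (λ x → 𝔼 (F x) g)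
𝔼-bind []            F g = refl
𝔼-bind ((x , p) ∷ D) F g = trans (∑-++ _ (map _ (F x)) (D >>= F)) (cong₂ _+_
  (trans (∑-map (λ (y , q) → q * g y) _ (F x))
    (trans (∑-cong (λ (y , q) → ℚ.*-assoc p q (g y)) (F x)) (∑-*ˡ p _ (F x))))
  (𝔼-bind D F g))

Almost-bind : ∀ {P : Ω → Set} {Q : Ω′ → Set} {D : Dist Ω} {F : Ω → Dist Ω′} →
              Almost P D → (∀ {x} → P x → Almost Q (F x)) → Almost Q (D >>= F)
Almost-bind []        PF = []
Almost-bind (Px ∷ PD) PF = All.++⁺ (All.map⁺ (PF Px)) (Almost-bind PD PF)

Almost-proportional : ∀ {P : Ω → Set} weight {xs} → All P xs → Almost P (proportional weight xs)
Almost-proportional weight Pxs = All.map⁺ Pxs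

ratio-cancel : ∀ a b .{{_ : NonZero b}} → ι b * ratio a b ≡ ι a
ratio-cancel a (suc b) = trans (ℚ.*-comm (ι (suc b)) (+ a / suc b)) (/-*-cancel (+ a) (suc b))

-- The total weight stays on the left as a factor, so each `ratio` cancels against it and the right
-- side is free of fractions.
𝔼-proportional : ∀ (weight : Ω → ℕ) xs (f : Ω → ℚ) .{{_ : NonZero (sum (map weight xs))}} →
  ι (sum (map weight xs)) * 𝔼 (proportional weight xs) f ≡ ∑ (λ x → ι (weight x) * f x) xs
𝔼-proportional weight xs f = begin
  ι W * 𝔼 (proportional weight xs) f
    ≡⟨ cong (ι W *_) (∑-map (λ (x , p) → p * f x) _ xs) ⟩
  ι W * ∑ (λ x → ratio (weight x) W * f x) xs           ≡⟨ ∑-*ˡ (ι W) _ xs ⟨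
  ∑ (λ x → ι W * (ratio (weight x) W * f x)) xs
    ≡⟨ ∑-cong (λ x → trans (sym (ℚ.*-assoc (ι W) (ratio (weight x) W) (f x)))
       (cong (_* f x) (ratio-cancel (weight x) W))) xs ⟩
  ∑ (λ x → ι (weight x) * f x) xs                       ∎
  where W = sum (map weight xs)

-- Counting subsets

private
  ∑-allSubsets-suc : ∀ n (f : Subset (suc n) → ℚ) →
    ∑ f (allSubsets (suc n)) ≡ ∑ (f ∘ (inside ∷_)) (allSubsets n) + ∑ (f ∘ (outside ∷_)) (allSubsets n)
  ∑-allSubsets-suc n f = trans (∑-++ f (map (inside ∷_) (allSubsets n)) _)
    (cong₂ _+_ (∑-map f (inside ∷_) (allSubsets n)) (∑-map f (outside ∷_) (allSubsets n)))

  -- The Boolean has the shape of the test in `subsetsOfSize`, so `∑-filter` produces it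
  -- definitionally, and it computes when the heads of `N` and `S` are known.
  sized : ℕ → Subset n → Subset n → ℚ
  sized m N S = 𝟙 (does (S ⊆? N) ∧ does (∣ S ∣ ℕ.≟ m))

  ∑-0* : ∀ (f : Ω → ℚ) xs → ∑ (λ x → 0ℚ * f x) xs ≡ 0ℚ
  ∑-0* f xs = trans (∑-cong (λ x → ℚ.*-zeroˡ (f x)) xs) (∑-zero xs)

  ∧-false : ∀ b → 𝟙 (b ∧ false) ≡ 0ℚ
  ∧-false true  = refl
  ∧-false false = refl

  C-pascal : ∀ p m → ι (p C m) + ι (p C suc m) ≡ ι (suc p C suc m)
  C-pascal p m = trans (sym (ι-+ (p C m) (p C suc m))) (cong ι (nCk+nC[k+1]≡[n+1]C[k+1] p m))

  -- Pascal's rule, according to whether the first element of `N` is selected.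
  count-sized : ∀ m (N : Subset n) → ∑ (sized m N) (allSubsets n) ≡ ι (∣ N ∣ C m)
  count-sized zero    [] = refl
  count-sized (suc m) [] = refl
  count-sized {suc n} m (outside ∷ N) = begin
    ∑ (sized m (outside ∷ N)) (allSubsets (suc n)) ≡⟨ ∑-allSubsets-suc n (sized m (outside ∷ N)) ⟩
    ∑ (const 0ℚ) (allSubsets n) + ∑ (sized m N) (allSubsets n)
      ≡⟨ cong₂ _+_ (∑-zero (allSubsets n)) (count-sized m N) ⟩
    0ℚ + ι (∣ N ∣ C m) ≡⟨ ℚ.+-identityˡ _ ⟩
    ι (∣ N ∣ C m) ∎
  count-sized {suc n} zero (inside ∷ N) = begin
    ∑ (sized 0 (inside ∷ N)) (allSubsets (suc n)) ≡⟨ ∑-allSubsets-suc n (sized 0 (inside ∷ N)) ⟩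
    ∑ (λ S → 𝟙 (does (S ⊆? N) ∧ false)) (allSubsets n) + ∑ (sized 0 N) (allSubsets n)
      ≡⟨ cong₂ _+_ (trans (∑-cong (λ S → ∧-false (does (S ⊆? N))) (allSubsets n)) (∑-zero (allSubsets n)))
         (count-sized 0 N) ⟩
    0ℚ + 1ℚ ≡⟨⟩
    1ℚ ∎
  count-sized {suc n} (suc m) (inside ∷ N) = begin
    ∑ (sized (suc m) (inside ∷ N)) (allSubsets (suc n))
      ≡⟨ ∑-allSubsets-suc n (sized (suc m) (inside ∷ N)) ⟩
    ∑ (sized m N) (allSubsets n) + ∑ (sized (suc m) N) (allSubsets n)
      ≡⟨ cong₂ _+_ (count-sized m N) (count-sized (suc m) N) ⟩
    ι (∣ N ∣ C m) + ι (∣ N ∣ C suc m) ≡⟨ C-pascal ∣ N ∣ m ⟩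
    ι (suc ∣ N ∣ C suc m) ∎

  sized-through : ℕ → Subset n → Fin n → Subset n → ℚ
  sized-through m N v S = sized m N S * 𝟙 (lookup S v)

  -- An empty set contains no `v`. This is the boundary term when the only slot of a one-element set
  -- is taken by something other than `v`.
  count-sized-through-0 : ∀ (N : Subset n) v → ∑ (sized-through 0 N v) (allSubsets n) ≡ 0ℚ
  count-sized-through-0 {n} N v = trans (∑-cong (none N v) (allSubsets n)) (∑-zero (allSubsets n))
    where
    none : ∀ {n} (N : Subset n) v S → sized-through 0 N v S ≡ 0ℚ
    none (outside ∷ N) v       (inside ∷ S)  = ℚ.*-zeroˡ (𝟙 (lookup (inside ∷ S) v))
    none (inside ∷ N)  v       (inside ∷ S)  =
      trans (cong (_* 𝟙 (lookup (inside ∷ S) v)) (∧-false (does (S ⊆? N)))) (ℚ.*-zeroˡ (𝟙 (lookup (inside ∷ S) v)))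
    none (_ ∷ N)       zero    (outside ∷ S) = ℚ.*-zeroʳ (sized 0 N S)
    none (_ ∷ N)       (suc v) (outside ∷ S) = none N v S

  -- One member is forced to be `v`, and the other `m` are free among the remaining elements of `N`.
  -- The induction is again Pascal's rule on the first element, until `v` itself is reached.
  count-sized-through : ∀ m (N : Subset n) v → lookup N v ≡ inside →
    ∑ (sized-through (suc m) N v) (allSubsets n) ≡ ι ((∣ N ∣ ∸ 1) C m)
  count-sized-through {suc n} m (inside ∷ N) zero _ = begin
    ∑ (sized-through (suc m) (inside ∷ N) zero) (allSubsets (suc n))
      ≡⟨ ∑-allSubsets-suc n (sized-through (suc m) (inside ∷ N) zero) ⟩
    ∑ (λ S → sized m N S * 1ℚ) (allSubsets n) + ∑ (λ S → sized (suc m) N S * 0ℚ) (allSubsets n)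
      ≡⟨ cong₂ _+_ (trans (∑-cong (λ S → ℚ.*-identityʳ (sized m N S)) (allSubsets n)) (count-sized m N))
                   (trans (∑-cong (λ S → ℚ.*-zeroʳ (sized (suc m) N S)) (allSubsets n)) (∑-zero (allSubsets n))) ⟩
    ι (∣ N ∣ C m) + 0ℚ ≡⟨ ℚ.+-identityʳ _ ⟩
    ι (∣ N ∣ C m) ∎
  count-sized-through {suc n} m (outside ∷ N) (suc v) v∈N = begin
    ∑ (sized-through (suc m) (outside ∷ N) (suc v)) (allSubsets (suc n))
      ≡⟨ ∑-allSubsets-suc n (sized-through (suc m) (outside ∷ N) (suc v)) ⟩
    ∑ (λ S → 0ℚ * 𝟙 (lookup S v)) (allSubsets n) + ∑ (sized-through (suc m) N v) (allSubsets n)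
      ≡⟨ cong₂ _+_ (∑-0* (λ S → 𝟙 (lookup S v)) (allSubsets n)) (count-sized-through m N v v∈N) ⟩
    0ℚ + ι ((∣ N ∣ ∸ 1) C m) ≡⟨ ℚ.+-identityˡ _ ⟩
    ι ((∣ N ∣ ∸ 1) C m) ∎
  count-sized-through {suc n} zero (inside ∷ N) (suc v) v∈N = begin
    ∑ (sized-through 1 (inside ∷ N) (suc v)) (allSubsets (suc n))
      ≡⟨ ∑-allSubsets-suc n (sized-through 1 (inside ∷ N) (suc v)) ⟩
    ∑ (sized-through 0 N v) (allSubsets n) + ∑ (sized-through 1 N v) (allSubsets n)
      ≡⟨ cong₂ _+_ (count-sized-through-0 N v) (count-sized-through 0 N v v∈N) ⟩
    0ℚ + 1ℚ ≡⟨⟩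
    1ℚ ∎
  count-sized-through {suc n} (suc m) (inside ∷ N) (suc v) v∈N = begin
    ∑ (sized-through (suc (suc m)) (inside ∷ N) (suc v)) (allSubsets (suc n))
      ≡⟨ ∑-allSubsets-suc n (sized-through (suc (suc m)) (inside ∷ N) (suc v)) ⟩
    ∑ (sized-through (suc m) N v) (allSubsets n) + ∑ (sized-through (suc (suc m)) N v) (allSubsets n)
      ≡⟨ cong₂ _+_ (count-sized-through m N v v∈N) (count-sized-through (suc m) N v v∈N) ⟩
    ι ((∣ N ∣ ∸ 1) C m) + ι ((∣ N ∣ ∸ 1) C suc m) ≡⟨ C-pascal (∣ N ∣ ∸ 1) m ⟩
    ι (suc (∣ N ∣ ∸ 1) C suc m)
      -- The tail still contains `v`, so the truncated subtraction is a genuine predecessor.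
      ≡⟨ cong (λ p → ι (p C suc m)) (ℕ.suc-pred ∣ N ∣ {{nonEmpty N v v∈N}}) ⟩
    ι (∣ N ∣ C suc m) ∎
    where
    nonEmpty : ∀ {n} (N : Subset n) v → lookup N v ≡ inside → NonZero ∣ N ∣
    nonEmpty (inside ∷ N)  _       _   = _
    nonEmpty (outside ∷ N) (suc v) v∈N = nonEmpty N v v∈N

∑-subsetsOfSize : ∀ m (N : Subset n) f → ∑ f (subsetsOfSize m N) ≡ ∑ (λ S → sized m N S * f S) (allSubsets n)
∑-subsetsOfSize m N f = ∑-filter _ f (allSubsets _)

number-subsetsOfSize : ∀ m (N : Subset n) → sum (map (const 1) (subsetsOfSize m N)) ≡ ∣ N ∣ C m
number-subsetsOfSize {n} m N = ι-injective (begin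
  ι (sum (map (const 1) (subsetsOfSize m N))) ≡⟨ ι-sum (const 1) (subsetsOfSize m N) ⟩
  ∑ (const 1ℚ) (subsetsOfSize m N)            ≡⟨ ∑-subsetsOfSize m N (const 1ℚ) ⟩
  ∑ (λ S → sized m N S * 1ℚ) (allSubsets n)   ≡⟨ ∑-cong (λ S → ℚ.*-identityʳ _) (allSubsets n) ⟩
  ∑ (sized m N) (allSubsets n)                ≡⟨ count-sized m N ⟩
  ι (∣ N ∣ C m)                               ∎)

∑-subsetsOfSize-through : ∀ m (N : Subset n) v → lookup N v ≡ inside →
  ∑ (λ S → 𝟙 (lookup S v)) (subsetsOfSize (suc m) N) ≡ ι ((∣ N ∣ ∸ 1) C m)
∑-subsetsOfSize-through m N v v∈N =
  trans (∑-subsetsOfSize (suc m) N (λ S → 𝟙 (lookup S v))) (count-sized-through m N v v∈N)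

-- Degrees

-- By absorption a positive multiple of the coefficient is a product of two nonzero numbers.
C-positive : ∀ {p m} → m ≤ p → NonZero (p C m)
C-positive {m = zero} _ = _
C-positive {suc p} {suc m} (s≤s m≤p) =
  ℕ.m*n≢0⇒n≢0 (suc m) {{subst NonZero (sym (absorption p m)) (ℕ.m*n≢0 (suc p) (p C m) {{_}} {{C-positive m≤p}})}}

ι-∣∣ : ∀ (S : Subset n) → ι ∣ S ∣ ≡ ∑ (λ i → 𝟙 (lookup S i)) (allFin n)
ι-∣∣ []                = refl
ι-∣∣ {suc n} (true ∷ S)  = trans (ι-suc ∣ S ∣)
   (trans (cong (_+_ 1ℚ) (ι-∣∣ S)) (sym (∑-allFin-suc n (λ i → 𝟙 (lookup (true ∷ S) i)))))
ι-∣∣ {suc n} (false ∷ S) = trans (trans (sym (ℚ.+-identityˡ _)) (cong (_+_ 0ℚ) (ι-∣∣ S)))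
   (sym (∑-allFin-suc n (λ i → 𝟙 (lookup (false ∷ S) i))))

ι-degree : ∀ (G : Graph n) v → ι (degree G v) ≡ ∑ (λ w → 𝟙 (adj G v w)) (allFin n)
ι-degree {n} G v = trans (ι-∣∣ (neighbours G v))
  (∑-cong (λ w → cong 𝟙 (lookup∘tabulate (adj G v) w)) (allFin n))

lookup-⁅⁆ : ∀ (w v : Fin n) → lookup ⁅ w ⁆ v ≡ does (w Fin.≟ v)
lookup-⁅⁆ zero    zero    = refl
lookup-⁅⁆ zero    (suc v) = lookup-replicate v outside
lookup-⁅⁆ (suc w) zero    = refl
lookup-⁅⁆ (suc w) (suc v) = lookup-⁅⁆ w v

lookup-⁅⁆∪ : ∀ (w v : Fin n) S → lookup (⁅ w ⁆ ∪ S) v ≡ does (w Fin.≟ v) ∨ lookup S v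
lookup-⁅⁆∪ w v S = trans (lookup-zipWith _∨_ v ⁅ w ⁆ S) (cong (_∨ lookup S v) (lookup-⁅⁆ w v))

∣⁅⁆∪∣ : ∀ (w : Fin n) S → lookup S w ≡ outside → ∣ ⁅ w ⁆ ∪ S ∣ ≡ suc ∣ S ∣
∣⁅⁆∪∣ zero    (outside ∷ S) _   = cong (suc ∘ ∣_∣) (∪-identityˡ S)
∣⁅⁆∪∣ (suc w) (outside ∷ S) w∉S = ∣⁅⁆∪∣ w S w∉S
∣⁅⁆∪∣ (suc w) (inside ∷ S)  w∉S = cong suc (∣⁅⁆∪∣ w S w∉S)

lookup-⊆ : ∀ {S N : Subset n} {v} → S ⊆ N → lookup N v ≡ outside → lookup S v ≡ outside
lookup-⊆ {S = S} {v = v} S⊆N v∉N with lookup S v in eq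
... | outside = refl
... | inside  = trans (sym ([]=⇒lookup (S⊆N (lookup⇒[]= v S eq)))) v∉N

-- The new vertex has the last index, whereas `∷` adds at the front; the two sizes are compared as
-- sums, with the last index split off. In this form the Boolean `lookup S v` alone decides whether
-- the degree grows.
degree-addVertex-old : ∀ (G : Graph n) S v → degree (addVertex G S) (inject₁ v) ≡ ∣ lookup S v ∷ neighbours G v ∣
degree-addVertex-old {n} G S v = ι-injective (begin
  ι (degree G′ (inject₁ v)) ≡⟨ ι-degree G′ (inject₁ v) ⟩
  ∑ (λ w → 𝟙 (adj G′ (inject₁ v) w)) (allFin (suc n))
    ≡⟨ ∑-allFin-last n (λ w → 𝟙 (adj G′ (inject₁ v) w)) ⟩
  ∑ (λ w → 𝟙 (adj G′ (inject₁ v) (inject₁ w))) (allFin n) + 𝟙 (adj G′ (inject₁ v) (fromℕ n))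
    ≡⟨ cong₂ _+_ (trans (∑-cong (λ w → cong 𝟙 (old-old w)) (allFin n)) (sym (ι-degree G v))) (cong 𝟙 old-new) ⟩
  ι (degree G v) + 𝟙 (lookup S v) ≡⟨ cons (lookup S v) ⟩
  ι ∣ lookup S v ∷ neighbours G v ∣ ∎)
  where
  G′ = addVertex G S
  old-old : ∀ w → adj G′ (inject₁ v) (inject₁ w) ≡ adj G v w
  old-old w rewrite view-inject₁ v | view-inject₁ w = refl
  old-new : adj G′ (inject₁ v) (fromℕ n) ≡ lookup S v
  old-new rewrite view-inject₁ v | view-fromℕ n = refl
  cons : ∀ b → ι (degree G v) + 𝟙 b ≡ ι ∣ b ∷ neighbours G v ∣
  cons true  = trans (ℚ.+-comm (ι (degree G v)) 1ℚ) (sym (ι-suc (degree G v)))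
  cons false = ℚ.+-identityʳ _

degree-addVertex-new : ∀ (G : Graph n) S → degree (addVertex G S) (fromℕ n) ≡ ∣ S ∣
degree-addVertex-new {n} G S = ι-injective (begin
  ι (degree G′ (fromℕ n)) ≡⟨ ι-degree G′ (fromℕ n) ⟩
  ∑ (λ w → 𝟙 (adj G′ (fromℕ n) w)) (allFin (suc n))
    ≡⟨ ∑-allFin-last n (λ w → 𝟙 (adj G′ (fromℕ n) w)) ⟩
  ∑ (λ w → 𝟙 (adj G′ (fromℕ n) (inject₁ w))) (allFin n) + 𝟙 (adj G′ (fromℕ n) (fromℕ n))
    ≡⟨ cong₂ _+_ (trans (∑-cong (λ w → cong 𝟙 (new-old w)) (allFin n)) (sym (ι-∣∣ S)))
       (cong 𝟙 (adj-irrefl G′ (fromℕ n))) ⟩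
  s + 0ℚ ≡⟨ ℚ.+-identityʳ _ ⟩
  s ∎)
  where
  G′ = addVertex G S
  s = ι ∣ S ∣
  new-old : ∀ w → adj G′ (fromℕ n) (inject₁ w) ≡ lookup S w
  new-old w rewrite view-inject₁ w | view-fromℕ n = refl

totalDegree : Graph n → ℕ
totalDegree {n} G = sum (map (degree G) (allFin n))

ι-totalDegree : ∀ (G : Graph n) → ι (totalDegree G) ≡ ∑ (ι ∘ degree G) (allFin n)
ι-totalDegree {n} G = ι-sum (degree G) (allFin n)

-- Each new edge is counted once at its old end and once at the new vertex.
totalDegree-addVertex : ∀ (G : Graph n) S → ι (totalDegree (addVertex G S)) ≡ ι (totalDegree G) + ι 2 * ι ∣ S ∣
totalDegree-addVertex {n} G S = begin
  ι (totalDegree G′) ≡⟨ ι-totalDegree G′ ⟩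
  ∑ (ι ∘ degree G′) (allFin (suc n)) ≡⟨ ∑-allFin-last n (ι ∘ degree G′) ⟩
  ∑ (ι ∘ degree G′ ∘ inject₁) (allFin n) + ι (degree G′ (fromℕ n))
    ≡⟨ cong₂ _+_ (trans (∑-cong old (allFin n)) (∑-+ (λ v → 𝟙 (lookup S v)) (ι ∘ degree G) (allFin n)))
       (cong ι (degree-addVertex-new G S)) ⟩
  ∑ (λ v → 𝟙 (lookup S v)) (allFin n) + ∑ (ι ∘ degree G) (allFin n) + s
    ≡⟨ cong₂ (λ y z → y + z + s) (sym (ι-∣∣ S)) (sym (ι-totalDegree G)) ⟩
  s + ι (totalDegree G) + s
    ≡⟨ solve 2 (λ a t → a :+ t :+ a := t :+ con (ι 2) :* a) refl s (ι (totalDegree G)) ⟩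
  ι (totalDegree G) + ι 2 * s ∎
  where
  open +-*-Solver
  G′ = addVertex G S
  s = ι ∣ S ∣
  cons : ∀ b v → ι ∣ b ∷ neighbours G v ∣ ≡ 𝟙 b + ι (degree G v)
  cons true  v = ι-suc (degree G v)
  cons false v = sym (ℚ.+-identityˡ _)
  old : ∀ v → ι (degree G′ (inject₁ v)) ≡ 𝟙 (lookup S v) + ι (degree G v)
  old v = trans (cong ι (degree-addVertex-old G S v)) (cons (lookup S v) v)

-- The attachment step, with k = l + 2

module _ (l : ℕ) (G : Graph n) (l<deg : ∀ w → suc l ≤ degree G w) where

  private
    candidates : Fin n → List (Subset n)
    candidates w = subsetsOfSize (suc l) (neighbours G w)

    All-candidates : ∀ w → All (λ S → S ⊆ neighbours G w × ∣ S ∣ ≡ suc l) (candidates w)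
    All-candidates w = All.all-filter _ (allSubsets n)

    uniform-candidates : ∀ w f → ι (degree G w C suc l) * 𝔼 (uniform (candidates w)) f ≡ ∑ f (candidates w)
    uniform-candidates w f = begin
      ι (degree G w C suc l) * 𝔼 (uniform (candidates w)) f
        ≡⟨ cong (λ N → ι N * 𝔼 (uniform (candidates w)) f) count ⟨
      ι (sum (map (const 1) (candidates w))) * 𝔼 (uniform (candidates w)) f
        ≡⟨ 𝔼-proportional (const 1) (candidates w) f {{subst NonZero (sym count) (C-positive (l<deg w))}} ⟩
      ∑ (λ S → 1ℚ * f S) (candidates w)
        ≡⟨ ∑-cong (λ S → ℚ.*-identityˡ (f S)) (candidates w) ⟩
      ∑ f (candidates w) ∎
      where
      count : sum (map (const 1) (candidates w)) ≡ degree G w C suc l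
      count = number-subsetsOfSize (suc l) (neighbours G w)

    ι-C-nonZero : ∀ w → ℚ.NonZero (ι (degree G w C suc l))
    ι-C-nonZero w = ι-nonZero (degree G w C suc l) {{C-positive (l<deg w)}}

    mass-candidates : ∀ w → 𝔼 (uniform (candidates w)) (const 1ℚ) ≡ 1ℚ
    mass-candidates w = *-cancelʳ (ι N) {{ι-C-nonZero w}} (begin
      𝔼 (uniform (candidates w)) (const 1ℚ) * ι N
        ≡⟨ ℚ.*-comm (𝔼 (uniform (candidates w)) (const 1ℚ)) (ι N) ⟩
      ι N * 𝔼 (uniform (candidates w)) (const 1ℚ) ≡⟨ uniform-candidates w (const 1ℚ) ⟩
      ∑ (const 1ℚ) (candidates w) ≡⟨ ι-sum (const 1) (candidates w) ⟨
      ι (sum (map (const 1) (candidates w)))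
        ≡⟨ cong ι (number-subsetsOfSize (suc l) (neighbours G w)) ⟩
      ι N ≡⟨ ℚ.*-identityˡ (ι N) ⟨
      1ℚ * ι N ∎)
      where N = degree G w C suc l

    -- With d the degree of `w`, C(d-1, l) of the C(d, l+1) candidate sets contain `v`, and by
    -- absorption this proportion is (l+1)/d.
    𝔼-through : ∀ w v → adj G w v ≡ true →
                ι (degree G w) * 𝔼 (uniform (candidates w)) (λ S → 𝟙 (lookup S v)) ≡ ι (suc l)
    𝔼-through w v wv = *-cancelʳ (ι N) {{ι-C-nonZero w}} (begin
      d * h * ι N       ≡⟨ solve 3 (λ d h N → d :* h :* N := d :* (N :* h)) refl d h (ι N) ⟩
      d * (ι N * h)     ≡⟨ cong (d *_) (uniform-candidates w (λ S → 𝟙 (lookup S v))) ⟩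
      d * ∑ (λ S → 𝟙 (lookup S v)) (candidates w)
        ≡⟨ cong (d *_) (∑-subsetsOfSize-through l (neighbours G w) v (trans (lookup∘tabulate (adj G w) v) wv)) ⟩
      d * ι ((degree G w ∸ 1) C l) ≡⟨ ι-* (degree G w) ((degree G w ∸ 1) C l) ⟨
      ι (degree G w ℕ.* ((degree G w ∸ 1) C l)) ≡⟨ cong ι (absorb (degree G w) (l<deg w)) ⟩
      ι (suc l ℕ.* N)   ≡⟨ ι-* (suc l) N ⟩
      ι (suc l) * ι N   ∎)
      where
      open +-*-Solver
      N = degree G w C suc l
      d = ι (degree G w)
      h = 𝔼 (uniform (candidates w)) (λ S → 𝟙 (lookup S v))
      absorb : ∀ p → suc l ≤ p → p ℕ.* ((p ∸ 1) C l) ≡ suc l ℕ.* (p C suc l)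
      absorb (suc p) _ = sym (absorption p l)

    -- The new vertex reaches `v` surely if `w` is `v`, through the chosen neighbours if `w` is
    -- adjacent to `v`, and otherwise never. Multiplied by its own weight, the contribution of `w`
    -- no longer involves the degree of `w`, so the sum over `w` depends only on the degree of `v`.
    hit : ∀ v w →
      ι (degree G w) * 𝔼 (uniform (candidates w)) (λ S → 𝟙 (lookup (⁅ w ⁆ ∪ S) v))
        ≡ 𝟙 (does (w Fin.≟ v)) * ι (degree G v) + 𝟙 (adj G v w) * ι (suc l)
    hit v w = trans
      (cong (ι (degree G w) *_) (∑-cong (λ (S , p) → cong (λ b → p * 𝟙 b) (lookup-⁅⁆∪ w v S))
        (uniform (candidates w))))
      (cases (w Fin.≟ v))
      where
      open +-*-Solver
      cases : (w≟v : Dec (w ≡ v)) →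
        ι (degree G w) * 𝔼 (uniform (candidates w)) (λ S → 𝟙 (does w≟v ∨ lookup S v))
          ≡ 𝟙 (does w≟v) * ι (degree G v) + 𝟙 (adj G v w) * ι (suc l)
      cases (yes refl) = begin
        ι (degree G w) * 𝔼 (uniform (candidates w)) (const 1ℚ)
          ≡⟨ cong (ι (degree G w) *_) (mass-candidates w) ⟩
        ι (degree G w) * 1ℚ
          ≡⟨ solve 2 (λ d l → d :* con 1ℚ := con 1ℚ :* d :+ con 0ℚ :* l) refl (ι (degree G w)) (ι (suc l)) ⟩
        1ℚ * ι (degree G w) + 0ℚ * ι (suc l)
          ≡⟨ cong (λ b → 1ℚ * ι (degree G w) + 𝟙 b * ι (suc l)) (adj-irrefl G w) ⟨
        1ℚ * ι (degree G w) + 𝟙 (adj G w w) * ι (suc l) ∎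
      cases (no _) with adj G v w in vw
      ... | true  = trans (𝔼-through w v (trans (adj-sym G w v) vw))
        (solve 2 (λ d l → l := con 0ℚ :* d :+ con 1ℚ :* l) refl (ι (degree G v)) (ι (suc l)))
      ... | false = begin
        ι (degree G w) * 𝔼 (uniform (candidates w)) (λ S → 𝟙 (lookup S v))
          ≡⟨ cong (ι (degree G w) *_) (𝔼-cong (Almost-proportional (const 1) (All-candidates w))
               λ {S} (S⊆N , _) → cong 𝟙 (lookup-⊆ S⊆N (trans (lookup∘tabulate (adj G w) v)
                 (trans (adj-sym G w v) vw)))) ⟩
        ι (degree G w) * 𝔼 (uniform (candidates w)) (const 0ℚ)
          ≡⟨ cong (ι (degree G w) *_) (𝔼-const (uniform (candidates w)) 0ℚ (mass-candidates w)) ⟩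
        ι (degree G w) * 0ℚ
          ≡⟨ solve 3 (λ e d l → e :* con 0ℚ := con 0ℚ :* d :+ con 0ℚ :* l) refl (ι (degree G w)) (ι (degree G v))
             (ι (suc l)) ⟩
        0ℚ * ι (degree G v) + 0ℚ * ι (suc l) ∎

    𝔼-step : ∀ f → 𝔼 (step (suc (suc l)) G) f ≡
      𝔼 (proportional (degree G) (allFin n)) (λ w →
        𝔼 (uniform (candidates w)) (λ S → f (addVertex G (⁅ w ⁆ ∪ S))))
    𝔼-step f = trans
      (𝔼-bind D₀ (λ w → uniform (candidates w) >>= λ S → return (addVertex G (⁅ w ⁆ ∪ S))) f)
      (∑-cong (λ (w , p) → cong (p *_) (trans
        (𝔼-bind (uniform (candidates w)) (λ S → return (addVertex G (⁅ w ⁆ ∪ S))) f)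
        (∑-cong (λ (S , q) → cong (q *_) (𝔼-return (addVertex G (⁅ w ⁆ ∪ S)) f)) (uniform (candidates w))))) D₀)
      where D₀ = proportional (degree G) (allFin n)

  -- No vertex is its own neighbour, so `w` lies outside the chosen set and the new vertex gets
  -- exactly `suc (suc l)` edges.
  Almost-step : ∀ {P : Graph (suc n) → Set} →
    (∀ S → ∣ S ∣ ≡ suc (suc l) → P (addVertex G S)) → Almost P (step (suc (suc l)) G)
  Almost-step {P} PG = Almost-bind (Almost-proportional (degree G) (All.universal (λ w → tt) (allFin n))) λ {w} _ →
    Almost-bind (Almost-proportional (const 1) (All-candidates w)) λ {S} (S⊆N , ∣S∣) →
      PG (⁅ w ⁆ ∪ S) (trans (∣⁅⁆∪∣ w S (lookup-⊆ S⊆N (trans (lookup∘tabulate (adj G w) w) (adj-irrefl G w))))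
        (cong suc ∣S∣)) ∷ []

  module _ .{{_ : NonZero (totalDegree G)}} where

    mass-step : 𝔼 (step (suc (suc l)) G) (const 1ℚ) ≡ 1ℚ
    mass-step = *-cancelʳ (ι D) {{ι-nonZero D}} (begin
      𝔼 (step (suc (suc l)) G) (const 1ℚ) * ι D ≡⟨ cong (_* ι D) (𝔼-step (const 1ℚ)) ⟩
      𝔼 D₀ (λ w → 𝔼 (uniform (candidates w)) (const 1ℚ)) * ι D
        ≡⟨ cong (_* ι D) (∑-cong (λ (w , p) → cong (p *_) (mass-candidates w)) D₀) ⟩
      𝔼 D₀ (const 1ℚ) * ι D ≡⟨ ℚ.*-comm (𝔼 D₀ (const 1ℚ)) (ι D) ⟩
      ι D * 𝔼 D₀ (const 1ℚ) ≡⟨ 𝔼-proportional (degree G) (allFin n) (const 1ℚ) ⟩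
      ∑ (λ w → ι (degree G w) * 1ℚ) (allFin n) ≡⟨ ∑-*ʳ 1ℚ (ι ∘ degree G) (allFin n) ⟩
      ∑ (ι ∘ degree G) (allFin n) * 1ℚ ≡⟨ cong (_* 1ℚ) (ι-totalDegree G) ⟨
      ι D * 1ℚ ≡⟨ ℚ.*-comm (ι D) 1ℚ ⟩
      1ℚ * ι D ∎)
      where
      D = totalDegree G
      D₀ = proportional (degree G) (allFin n)

    -- A vertex of degree d is hit with probability kd / totalDegree: it is
    -- chosen itself with weight d, and each of its d neighbours w passes its
    -- weight d(w) on to it with probability (k - 1) / d(w).
    generator : ∀ v (g : ℕ → ℚ) →
      ι (totalDegree G) * 𝔼 (step (suc (suc l)) G) (λ G′ → g (degree G′ (inject₁ v)))
        ≡ ι (totalDegree G) * g (degree G v)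
          + ι (suc (suc l)) * ι (degree G v) * (g (suc (degree G v)) - g (degree G v))
    generator v g = begin
      ι D * 𝔼 (step (suc (suc l)) G) (λ G′ → g (degree G′ (inject₁ v)))
        ≡⟨ cong (ι D *_) (𝔼-step (λ G′ → g (degree G′ (inject₁ v)))) ⟩
      ι D * 𝔼 (proportional (degree G) (allFin n)) (λ w → 𝔼 (U w)
        (λ S → g (degree (addVertex G (⁅ w ⁆ ∪ S)) (inject₁ v))))
        ≡⟨ 𝔼-proportional (degree G) (allFin n) (λ w → 𝔼 (U w)
           (λ S → g (degree (addVertex G (⁅ w ⁆ ∪ S)) (inject₁ v)))) ⟩
      ∑ (λ w → ι (degree G w) * 𝔼 (U w) (λ S → g (degree (addVertex G (⁅ w ⁆ ∪ S)) (inject₁ v)))) (allFin n)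
        ≡⟨ ∑-cong per-w (allFin n) ⟩
      ∑ (λ w → ι (degree G w) * a + gain w * δ) (allFin n)
        ≡⟨ trans (∑-+ (λ w → ι (degree G w) * a) (λ w → gain w * δ) (allFin n))
           (cong₂ _+_ (∑-*ʳ a (ι ∘ degree G) (allFin n)) (∑-*ʳ δ gain (allFin n))) ⟩
      ∑ (ι ∘ degree G) (allFin n) * a + ∑ gain (allFin n) * δ
        ≡⟨ cong₂ (λ y z → y * a + z * δ) (sym (ι-totalDegree G)) ∑gain ⟩
      ι D * a + ι (suc (suc l)) * ι (degree G v) * δ ∎
      where
      open +-*-Solver
      D = totalDegree G
      a = g (degree G v)
      δ = g (suc (degree G v)) - a
      U = λ w → uniform (candidates w)
      gain = λ w → 𝟙 (does (w Fin.≟ v)) * ι (degree G v) + 𝟙 (adj G v w) * ι (suc l)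
      ∑gain : ∑ gain (allFin n) ≡ ι (suc (suc l)) * ι (degree G v)
      ∑gain = begin
        ∑ gain (allFin n)
          ≡⟨ ∑-+ (λ w → 𝟙 (does (w Fin.≟ v)) * ι (degree G v)) (λ w → 𝟙 (adj G v w) * ι (suc l)) (allFin n) ⟩
        ∑ (λ w → 𝟙 (does (w Fin.≟ v)) * ι (degree G v)) (allFin n) + ∑ (λ w → 𝟙 (adj G v w) * ι (suc l)) (allFin n)
          ≡⟨ cong₂ _+_ (∑-δ v (ι (degree G v))) (trans (∑-*ʳ (ι (suc l)) (λ w → 𝟙 (adj G v w)) (allFin n))
             (cong (_* ι (suc l)) (sym (ι-degree G v)))) ⟩
        ι (degree G v) + ι (degree G v) * ι (suc l)
          ≡⟨ solve 2 (λ d l → d :+ d :* l := (con 1ℚ :+ l) :* d) refl (ι (degree G v)) (ι (suc l)) ⟩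
        (1ℚ + ι (suc l)) * ι (degree G v) ≡⟨ cong (_* ι (degree G v)) (ι-suc (suc l)) ⟨
        ι (suc (suc l)) * ι (degree G v) ∎
      -- A function of a degree that moves by 0 or 1 is affine in the indicator of the move, so only
      -- the hit probability enters its expectation.
      interpolate : ∀ b → g ∣ b ∷ neighbours G v ∣ ≡ a + 𝟙 b * δ
      interpolate true  = solve 2 (λ c a → c := a :+ con 1ℚ :* (c :- a)) refl (g (suc (degree G v))) a
      interpolate false = solve 2 (λ d a → a := a :+ con 0ℚ :* d) refl δ a
      per-w : ∀ w → ι (degree G w) * 𝔼 (U w) (λ S → g (degree (addVertex G (⁅ w ⁆ ∪ S)) (inject₁ v))) ≡ ι (degree G w)
        * a + gain w * δ
      per-w w = begin
        dw * 𝔼 (U w) (λ S → g (degree (addVertex G (⁅ w ⁆ ∪ S)) (inject₁ v)))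
          ≡⟨ cong (dw *_) (∑-cong (λ (S , p) → cong (p *_)
             (trans (cong g (degree-addVertex-old G (⁅ w ⁆ ∪ S) v)) (interpolate (lookup (⁅ w ⁆ ∪ S) v)))) (U w)) ⟩
        dw * 𝔼 (U w) (λ S → a + 𝟙 (lookup (⁅ w ⁆ ∪ S) v) * δ)
          ≡⟨ cong (dw *_) (trans (𝔼-+ (U w) (const a) (λ S → 𝟙 (lookup (⁅ w ⁆ ∪ S) v) * δ))
               (cong₂ _+_ (𝔼-const (U w) a (mass-candidates w)) (𝔼-*ʳ (U w) (λ S → 𝟙 (lookup (⁅ w ⁆ ∪ S) v)) δ))) ⟩
        dw * (a + h * δ)
          ≡⟨ solve 4 (λ d a h e → d :* (a :+ h :* e) := d :* a :+ (d :* h) :* e) refl dw a h δ ⟩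
        dw * a + (dw * h) * δ ≡⟨ cong (λ z → dw * a + z * δ) (hit v w) ⟩
        dw * a + gain w * δ ∎
        where
        dw = ι (degree G w)
        h = 𝔼 (U w) (λ S → 𝟙 (lookup (⁅ w ⁆ ∪ S) v))

-- The complete graph

∣tabulate-true∣ : ∀ n → ∣ tabulate {n = n} (λ _ → true) ∣ ≡ n
∣tabulate-true∣ zero    = refl
∣tabulate-true∣ (suc n) = cong suc (∣tabulate-true∣ n)

degree-complete : ∀ (x : Fin (suc n)) → degree (complete (suc n)) x ≡ n
degree-complete {n}     zero    = ∣tabulate-true∣ n
degree-complete {suc n} (suc x) = cong suc (degree-complete x)

totalDegree-complete : ∀ n → ι (totalDegree (complete n)) ≡ ι (n ℕ.* (n ∸ 1))
totalDegree-complete zero    = refl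
totalDegree-complete (suc n) = begin
  ι (totalDegree (complete (suc n)))                 ≡⟨ ι-totalDegree (complete (suc n)) ⟩
  ∑ (ι ∘ degree (complete (suc n))) (allFin (suc n))
    ≡⟨ ∑-cong (λ x → cong ι (degree-complete x)) (allFin (suc n)) ⟩
  ∑ (const (ι n)) (allFin (suc n))                   ≡⟨ ∑-const (suc n) (ι n) ⟩
  ι (suc n) * ι n                                    ≡⟨ ι-* (suc n) n ⟨
  ι (suc n ℕ.* n)                                    ∎

-- The law of a degree

÷-*-cancel : ∀ p q .{{_ : ℚ.NonZero q}} → (p ÷ q) * q ≡ p
÷-*-cancel p q = trans (ℚ.*-assoc p (ℚ.1/ q) q)
  (trans (cong (p *_) (ℚ.*-inverseˡ q)) (ℚ.*-identityʳ p))

-- Under the indicator, the random degree may be replaced by the fixed value; this turns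
-- coefficients that depend on the graph into constants.
𝟙-≟-* : ∀ m d → 𝟙 (does (m ≟ d)) * ι m ≡ 𝟙 (does (m ≟ d)) * ι d
𝟙-≟-* m d = cases (m ≟ d)
  where
  cases : (m≟d : Dec (m ≡ d)) → 𝟙 (does m≟d) * ι m ≡ 𝟙 (does m≟d) * ι d
  cases (yes refl) = refl
  cases (no _)     = trans (ℚ.*-zeroˡ (ι m)) (sym (ℚ.*-zeroˡ (ι d)))

-- The right side is the total degree of K_j, which fixes the starting value of `τ` below.
R-scaled : ∀ k j (2≤k : 2 ≤ k) → ι 2 * R k j 2≤k * ι k ≡ ι (j ℕ.* (j ∸ 1))
R-scaled k j 2≤k = begin
  ι 2 * R k j 2≤k * ι k   ≡⟨ ring (ι 2) (R k j 2≤k) (ι k) ⟩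
  R k j 2≤k * (ι 2 * ι k) ≡⟨ cong (R k j 2≤k *_) (ι-* 2 k) ⟨
  R k j 2≤k * ι (2 ℕ.* k) ≡⟨ /-*-cancel (+ (j ℕ.* (j ∸ 1))) (2 ℕ.* k) {{2k≢0 2≤k}} ⟩
  ι (j ℕ.* (j ∸ 1))       ∎
  where
  open +-*-Solver
  ring : ∀ t r k → t * r * k ≡ r * (t * k)
  ring = solve 3 (λ t r k → t :* r :* k := r :* (t :* k)) refl

-- The law of one degree along the process

module Process (l j : ℕ) (k<j : suc (suc l) ℕ.+ 1 ≤ j)
  -- `R k j 2≤k` enters as an opaque `r` with the few facts used about it, so its normalised
  -- fraction is never unfolded.
  (r : ℚ) (r-positive : Positive r) (r-scaled : ι 2 * r * ι (suc (suc l)) ≡ ι (j ℕ.* (j ∸ 1)))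
  (falling≢0 : ∀ {n m} → j ≤ n → m ≤ n ∸ j → ℚ.NonZero ([ ι n - ι j + r - 1ℚ ]↓ m)) where

  private
    k : ℕ
    k = suc (suc l)

  -- A vertex of degree d of Gₙ gains an edge with probability d / τ n.
  τ : ℕ → ℚ
  τ n = ι 2 * (ι n - ι j + r)

  τ-positive : j ≤ n → Positive (τ n)
  τ-positive {n} j≤n = ℚ.pos*pos⇒pos (ι 2) (ι n - ι j + r) {{subst Positive eq
      (ℚ.pos+nonNeg⇒pos r {{r-positive}} (ι (n ∸ j)))}}
    where
    open +-*-Solver
    ring : ∀ r d j → r + d ≡ d + j - j + r
    ring = solve 3 (λ r d j → r :+ d := d :+ j :- j :+ r) refl
    eq : r + ι (n ∸ j) ≡ ι n - ι j + r
    eq = trans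
      (ring r (ι (n ∸ j)) (ι j))
      (cong (λ z → z - ι j + r) (trans (sym (ι-+ (n ∸ j) j)) (cong ι (ℕ.m∸n+n≡m j≤n))))

  -- The first field ensures that sets of k-1 neighbours exist to choose from; the second makes the
  -- hit probability of a given degree the same in every graph that can occur at time `n`.
  record Valid (G : Graph n) : Set where
    field
      minDegree  : ∀ w → k ≤ degree G w
      total≡kτ : ι (totalDegree G) ≡ ι k * τ n

  open Valid

  valid-complete : Valid (complete j)
  valid-complete .minDegree = min j k<j
    where
    min : ∀ j → k ℕ.+ 1 ≤ j → (w : Fin j) → k ≤ degree (complete j) w
    min (suc j) k<j w = subst (k ≤_) (sym (degree-complete w))
      (ℕ.≤-pred (subst (_≤ suc j) (ℕ.+-comm k 1) k<j))
  valid-complete .total≡kτ = begin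
    ι (totalDegree (complete j))    ≡⟨ totalDegree-complete j ⟩
    ι (j ℕ.* (j ∸ 1))               ≡⟨ r-scaled ⟨
    ι 2 * r * ι k                   ≡⟨ ring (ι 2) r (ι k) (ι j) ⟩
    ι k * τ j                       ∎
    where
    open +-*-Solver
    ring : ∀ t r k j → t * r * k ≡ k * (t * (j - j + r))
    ring = solve 4 (λ t r k j → t :* r :* k := k :* (t :* (j :- j :+ r))) refl

  -- The total degree grows by 2k while `τ` grows by 2, and old degrees never decrease.
  valid-addVertex : ∀ {G : Graph n} → Valid G → ∀ S → ∣ S ∣ ≡ k → Valid (addVertex G S)
  valid-addVertex {n} {G} valid S ∣S∣≡k .minDegree w = cases (view w)
    where
    cases : ∀ {w} → View w → k ≤ degree (addVertex G S) w
    cases ‵fromℕ       = ℕ.≤-reflexive (sym (trans (degree-addVertex-new G S) ∣S∣≡k))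
    cases (‵inject₁ v) = ≤-trans (minDegree valid v)
      (subst (degree G v ≤_) (sym (degree-addVertex-old G S v)) (∣p∣≤∣x∷p∣ (lookup S v) (neighbours G v)))
  valid-addVertex {n} {G} valid S ∣S∣≡k .total≡kτ = begin
    ι (totalDegree (addVertex G S))     ≡⟨ totalDegree-addVertex G S ⟩
    ι (totalDegree G) + ι 2 * ι ∣ S ∣   ≡⟨ cong₂ (λ y z → y + ι 2 * ι z) (total≡kτ valid) ∣S∣≡k ⟩
    ι k * τ n + ι 2 * ι k
      ≡⟨ ring (ι 2) (ι k) (ι n) (ι j) r ⟩
    ι k * (ι 2 * (1ℚ + ι n - ι j + r))  ≡⟨ cong (λ z → ι k * (ι 2 * (z - ι j + r))) (ι-suc n) ⟨
    ι k * τ (suc n)                     ∎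
    where
    open +-*-Solver
    ring : ∀ t k n j r → k * (t * (n - j + r)) + t * k ≡ k * (t * (1ℚ + n - j + r))
    ring = solve 5 (λ t k n j r → k :* (t :* (n :- j :+ r)) :+ t :* k := k :* (t :* (con 1ℚ :+ n :- j :+ r))) refl

  module _ (j≤n : j ≤ n) {G : Graph n} (valid : Valid G) where

    l<degree : ∀ w → suc l ≤ degree G w
    l<degree w = <⇒≤ (minDegree valid w)

    totalDegree-nonZero : NonZero (totalDegree G)
    totalDegree-nonZero = positive⇒nonZero (totalDegree G)
      (subst Positive (sym (total≡kτ valid)) (ℚ.pos*pos⇒pos (ι k) (τ n) {{τ-positive j≤n}}))
      where
      positive⇒nonZero : ∀ a → Positive (ι a) → NonZero a
      positive⇒nonZero (suc a) _ = _

    -- This is `generator` with the common factor k cancelled: weight d on moving up, weight `τ n`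
    -- minus d on staying.
    drift : ∀ v (g : ℕ → ℚ) →
      𝔼 (step k G) (λ G′ → g (degree G′ (inject₁ v))) * τ n
        ≡ g (degree G v) * (τ n - ι (degree G v)) + g (suc (degree G v)) * ι (degree G v)
    drift v g = *-cancelʳ (ι k) (begin
      E * τ n * ι k                 ≡⟨ ring₁ E (τ n) (ι k) ⟩
      ι k * τ n * E                 ≡⟨ cong (_* E) (total≡kτ valid) ⟨
      ι (totalDegree G) * E         ≡⟨ generator l G l<degree {{totalDegree-nonZero}} v g ⟩
      ι (totalDegree G) * a + ι k * d * (a′ - a)
        ≡⟨ cong (λ z → z * a + ι k * d * (a′ - a)) (total≡kτ valid) ⟩
      ι k * τ n * a + ι k * d * (a′ - a)
        ≡⟨ ring₂ (ι k) (τ n) a d a′ ⟩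
      (a * (τ n - d) + a′ * d) * ι k ∎)
      where
      open +-*-Solver
      E = 𝔼 (step k G) (λ G′ → g (degree G′ (inject₁ v)))
      d = ι (degree G v)
      a = g (degree G v)
      a′ = g (suc (degree G v))
      ring₁ : ∀ e t k → e * t * k ≡ k * t * e
      ring₁ = solve 3 (λ e t k → e :* t :* k := k :* t :* e) refl
      ring₂ : ∀ k t a d b → k * t * a + k * d * (b - a) ≡ (a * (t - d) + b * d) * k
      ring₂ = solve 5 (λ k t a d b → k :* t :* a :+ k :* d :* (b :- a) := (a :* (t :- d) :+ b :* d) :* k) refl

  valid-process : (p : j ≤′ n) → Almost Valid (process k p)
  valid-process ≤′-refl     = valid-complete ∷ []
  valid-process (≤′-step p) = Almost-bind (valid-process p)
    λ {G} valid → Almost-step l G (l<degree (ℕ.≤′⇒≤ p) valid) (valid-addVertex valid)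

  mass-process : (p : j ≤′ n) → 𝔼 (process k p) (const 1ℚ) ≡ 1ℚ
  mass-process ≤′-refl     = 𝔼-return (complete j) (const 1ℚ)
  mass-process (≤′-step p) = begin
    𝔼 (process k p >>= step k) (const 1ℚ)
      ≡⟨ 𝔼-bind (process k p) (step k) (const 1ℚ) ⟩
    𝔼 (process k p) (λ G → 𝔼 (step k G) (const 1ℚ))
      ≡⟨ 𝔼-cong (valid-process p) (λ {G} valid → mass-step l G (l<degree (ℕ.≤′⇒≤ p) valid)
         {{totalDegree-nonZero (ℕ.≤′⇒≤ p) valid}}) ⟩
    𝔼 (process k p) (const 1ℚ)                            ≡⟨ mass-process p ⟩
    1ℚ                                                    ∎

  degreeLaw : j ≤′ n → Fin n → ℕ → ℚ
  degreeLaw p v d = 𝔼 (process k p) (λ G → 𝟙 (does (degree G v ≟ d)))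

  -- `drift` is applied to the indicator of a single degree and averaged over the graphs at time
  -- `n`.
  degreeLaw-evolves : ∀ (p : j ≤′ n) v → Evolves (τ n) (degreeLaw p v) (degreeLaw (≤′-step p) (inject₁ v))
  degreeLaw-evolves {n} p v = record { evolves-zero = at-zero ; evolves-suc = at-suc }
    where
    open +-*-Solver
    D = process k p
    eq : ∀ d → 𝔼 (D >>= step k) (λ G → 𝟙 (does (degree G (inject₁ v) ≟ d))) * τ n ≡
      𝔼 D (λ G → 𝟙 (does (degree G v ≟ d)) * (τ n - ι (degree G v)) + 𝟙 (does (suc (degree G v) ≟ d)) * ι
        (degree G v))
    eq d = begin
      𝔼 (D >>= step k) (λ G → 𝟙 (does (degree G (inject₁ v) ≟ d))) * τ n
        ≡⟨ cong (_* τ n) (𝔼-bind D (step k) (λ G → 𝟙 (does (degree G (inject₁ v) ≟ d)))) ⟩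
      𝔼 D (λ G → 𝔼 (step k G) (λ G′ → 𝟙 (does (degree G′ (inject₁ v) ≟ d)))) * τ n
        ≡⟨ 𝔼-*ʳ D (λ G → 𝔼 (step k G) (λ G′ → 𝟙 (does (degree G′ (inject₁ v) ≟ d)))) (τ n) ⟨
      𝔼 D (λ G → 𝔼 (step k G) (λ G′ → 𝟙 (does (degree G′ (inject₁ v) ≟ d))) * τ n)
        ≡⟨ 𝔼-cong (valid-process p) (λ valid → drift (ℕ.≤′⇒≤ p) valid v (λ m → 𝟙 (does (m ≟ d)))) ⟩
      𝔼 D (λ G → 𝟙 (does (degree G v ≟ d)) * (τ n - ι (degree G v)) + 𝟙 (does (suc (degree G v) ≟ d)) * ι
        (degree G v)) ∎
    stay : ∀ m d → 𝟙 (does (m ≟ d)) * (τ n - ι m) ≡ 𝟙 (does (m ≟ d)) * (τ n - ι d)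
    stay m d = begin
      b * (τ n - ι m)     ≡⟨ ring b (τ n) (ι m) ⟩
      b * τ n - b * ι m   ≡⟨ cong (λ z → b * τ n - z) (𝟙-≟-* m d) ⟩
      b * τ n - b * ι d   ≡⟨ ring b (τ n) (ι d) ⟨
      b * (τ n - ι d)     ∎
      where
      b = 𝟙 (does (m ≟ d))
      ring : ∀ b t m → b * (t - m) ≡ b * t - b * m
      ring = solve 3 (λ b t m → b :* (t :- m) := b :* t :- b :* m) refl
    at-zero : degreeLaw (≤′-step p) (inject₁ v) 0 * τ n ≡ degreeLaw p v 0 * τ n
    at-zero = trans (eq 0) (trans
      -- No degree moves up to 0: the test `suc (degree G v) ≟ 0` computes to false.
      (∑-cong (λ (G , q) → cong (q *_) (trans (cong (λ z → z + 0ℚ * ι (degree G v)) (stay (degree G v) 0))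
        (ring (𝟙 (does (degree G v ≟ 0))) (τ n) (ι (degree G v))))) D)
      (𝔼-*ʳ D (λ G → 𝟙 (does (degree G v ≟ 0))) (τ n)))
      where
      ring : ∀ b t m → b * (t - 0ℚ) + 0ℚ * m ≡ b * t
      ring = solve 3 (λ b t m → b :* (t :- con 0ℚ) :+ con 0ℚ :* m := b :* t) refl
    at-suc : ∀ d → degreeLaw (≤′-step p) (inject₁ v) (suc d) * τ n ≡
      degreeLaw p v (suc d) * (τ n - ι (suc d)) + degreeLaw p v d * ι d
    at-suc d = trans (eq (suc d)) (trans
      (∑-cong (λ (G , q) → cong (q *_) (cong₂ _+_ (stay (degree G v) (suc d)) (𝟙-≟-* (degree G v) d))) D)
      (trans (𝔼-+ D (λ G → 𝟙 (does (degree G v ≟ suc d)) * (τ n - ι (suc d))) (λ G → 𝟙 (does (degree G v ≟ d)) * ι d))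
        (cong₂ _+_ (𝔼-*ʳ D (λ G → 𝟙 (does (degree G v ≟ suc d))) (τ n - ι (suc d)))
                   (𝔼-*ʳ D (λ G → 𝟙 (does (degree G v ≟ d))) (ι d)))))

  law-deterministic : ∀ {e A} (p : j ≤′ n) v → (∀ u → A u ≡ 1ℚ) →
    Almost (λ G → degree G v ≡ suc e) (process k p) → Law e A (degreeLaw p v)
  law-deterministic {e = e} p v A≡1 deg = law-init A≡1
    (trans (𝔼-cong deg (λ {G} d≡ → cong 𝟙 (dec-true (degree G v ≟ suc e) d≡))) (mass-process p))
    (λ {d} d≢ → trans (𝔼-cong deg (λ {G} d≡ → cong 𝟙 (dec-false (degree G v ≟ d) (λ d≡d → d≢ (trans (sym d≡d) d≡)))))
      (𝔼-const (process k p) 0ℚ (mass-process p)))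

  -- Quotients of falling factorials

  quotient : ∀ n m → .(j ≤ n) → .(m ≤ n ∸ j) → ℚ → ℚ
  quotient n m j≤n m≤ y =
    ([ ι n - ι j + y - 1ℚ ]↓ m ÷ [ ι n - ι j + r - 1ℚ ]↓ m) {{falling≢0 j≤n m≤}}

  -- When `n` and the length both grow by one, the old factors stay and a single new one appears on
  -- top.
  falling-suc : ∀ n m y → [ ι (suc n) - ι j + y - 1ℚ ]↓ suc m ≡ (ι n - ι j + y) * [ ι n - ι j + y - 1ℚ ]↓ m
  falling-suc n m y = cong ([_]↓ suc m) (trans
    (cong (λ z → z - ι j + y - 1ℚ) (ι-suc n))
    (ring (ι n) (ι j) y))
    where
    open +-*-Solver
    ring : ∀ n j y → 1ℚ + n - j + y - 1ℚ ≡ n - j + y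
    ring = solve 3 (λ n j y → con 1ℚ :+ n :- j :+ y :- con 1ℚ := n :- j :+ y) refl

  -- The quotient of the two new top factors is (n-j+y)/(n-j+r). Twice its denominator is `τ n`, and
  -- by the hypothesis on `y` twice its numerator is `τ n` minus `δ`.
  quotient-step : ∀ n m (j≤n : j ≤ n) (m≤ : m ≤ n ∸ j) (j≤n′ : j ≤ suc n) (m≤′ : suc m ≤ suc n ∸ j) y δ →
    ι 2 * y ≡ ι 2 * r - δ →
    quotient (suc n) (suc m) j≤n′ m≤′ y * τ n ≡ quotient n m j≤n m≤ y * (τ n - δ)
  quotient-step n m j≤n m≤ j≤n′ m≤′ y δ 2y≡ = *-cancelʳ b {{b≢0}} (begin
    (a′ ÷ b′) {{b′≢0}} * τ n * b            ≡⟨ ring₁ (ι 2) ((a′ ÷ b′) {{b′≢0}}) (s + r) b ⟩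
    (a′ ÷ b′) {{b′≢0}} * ((s + r) * b) * ι 2
      ≡⟨ cong (λ z → (a′ ÷ b′) {{b′≢0}} * z * ι 2) (falling-suc n m r) ⟨
    (a′ ÷ b′) {{b′≢0}} * b′ * ι 2           ≡⟨ cong (_* ι 2) (÷-*-cancel a′ b′ {{b′≢0}}) ⟩
    a′ * ι 2                                ≡⟨ cong (_* ι 2) (falling-suc n m y) ⟩
    (s + y) * a * ι 2                       ≡⟨ ring₂ (ι 2) s y a ⟩
    a * (ι 2 * s + ι 2 * y)                 ≡⟨ cong (λ z → a * (ι 2 * s + z)) 2y≡ ⟩
    a * (ι 2 * s + (ι 2 * r - δ))
      ≡⟨ cong (_* (ι 2 * s + (ι 2 * r - δ))) (÷-*-cancel a b {{b≢0}}) ⟨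
    (a ÷ b) {{b≢0}} * b * (ι 2 * s + (ι 2 * r - δ))
      ≡⟨ ring₃ (ι 2) ((a ÷ b) {{b≢0}}) b s r δ ⟩
    (a ÷ b) {{b≢0}} * (τ n - δ) * b         ∎)
    where
    open +-*-Solver
    s = ι n - ι j
    a = [ ι n - ι j + y - 1ℚ ]↓ m
    b = [ ι n - ι j + r - 1ℚ ]↓ m
    a′ = [ ι (suc n) - ι j + y - 1ℚ ]↓ suc m
    b′ = [ ι (suc n) - ι j + r - 1ℚ ]↓ suc m
    b≢0 : ℚ.NonZero b
    b≢0 = falling≢0 j≤n m≤
    b′≢0 : ℚ.NonZero b′
    b′≢0 = falling≢0 j≤n′ m≤′
    ring₁ : ∀ t q s b → q * (t * s) * b ≡ q * (s * b) * t
    ring₁ = solve 4 (λ t q s b → q :* (t :* s) :* b := q :* (s :* b) :* t) refl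
    ring₂ : ∀ t s y a → (s + y) * a * t ≡ a * (t * s + t * y)
    ring₂ = solve 4 (λ t s y a → (s :+ y) :* a :* t := a :* (t :* s :+ t :* y)) refl
    ring₃ : ∀ t q b s r δ → q * b * (t * s + (t * r - δ)) ≡ q * (t * (s + r) - δ) * b
    ring₃ = solve 6 (λ t q b s r δ → q :* b :* (t :* s :+ (t :* r :- δ)) := q :* (t :* (s :+ r) :- δ) :* b) refl

  -- A vertex whose degree at time `i` is known to be `suc e`

  module _ (e i t : ℕ) (j≤i : j ≤ i) (t<i : t < i) (y : ℕ → ℚ) (2y≡ : ∀ u → ι 2 * y u ≡ ι 2 * r - ι (suc (u ℕ.+ e)))
    (base : (p : j ≤′ i) → Almost (λ G → degree G (fromℕ< t<i) ≡ suc e) (process k p)) where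

    degreeLaw-closed : ∀ m (m≤ : m ≤ (m ℕ.+ i) ∸ j) (p : j ≤′ m ℕ.+ i) .(t<n : t < m ℕ.+ i) (j≤n : j ≤ m ℕ.+ i) →
      Law e (λ u → quotient (m ℕ.+ i) m j≤n m≤ (y u)) (degreeLaw p (fromℕ< t<n))
    -- No step has been made since time `i`: both falling factorials are empty and each quotient
    -- computes to 1.
    degreeLaw-closed zero m≤ p t<n j≤n = law-deterministic p (fromℕ< t<i) (λ _ → refl) (base p)
    degreeLaw-closed (suc m) _ ≤′-refl _ _ = contradiction (ℕ.m≤n+m i m) (ℕ.<⇒≱ j≤i)
    degreeLaw-closed (suc m) m≤ (≤′-step p) t<n j≤n =
      -- The same vertex is named by `inject₁` in the recurrence and by `fromℕ<` in the statement.
      subst (λ v → Law e A′ (degreeLaw (≤′-step p) v)) (inject₁-fromℕ< t (m ℕ.+ i) (ℕ.≤-trans t<i (ℕ.m≤n+m i m)) t<n)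
        (law-step (τ (m ℕ.+ i)) {{ℚ.pos⇒nonZero (τ (m ℕ.+ i)) {{τ-positive (ℕ.≤′⇒≤ p)}}}}
          (λ u → quotient-step (m ℕ.+ i) m (ℕ.≤′⇒≤ p) m≤₀ j≤n m≤ (y u) (ι (suc (u ℕ.+ e))) (2y≡ u))
          (degreeLaw-evolves p (fromℕ< (ℕ.≤-trans t<i (ℕ.m≤n+m i m))))
          (degreeLaw-closed m m≤₀ p (ℕ.≤-trans t<i (ℕ.m≤n+m i m)) (ℕ.≤′⇒≤ p)))
      where
      A′ = λ u → quotient (suc m ℕ.+ i) (suc m) j≤n m≤ (y u)
      m≤₀ : m ≤ (m ℕ.+ i) ∸ j
      m≤₀ = ℕ.≤-trans (ℕ.m≤m+n m (i ∸ j)) (ℕ.≤-reflexive (sym (ℕ.+-∸-assoc m j≤i)))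
      inject₁-fromℕ< : ∀ t n .(t<n : t < n) .(t<1+n : t < suc n) → inject₁ (fromℕ< t<n) ≡ fromℕ< t<1+n
      inject₁-fromℕ< zero    (suc n) _   _     = refl
      inject₁-fromℕ< (suc t) (suc n) t<n t<1+n = cong suc (inject₁-fromℕ< t n (ℕ.s<s⁻¹ t<n) (ℕ.s<s⁻¹ t<1+n))

    -- The time `n`, the degree `d` and the upper index `c` are variables tied down by equations, so
    -- that they can take the different spellings of the two parts of the theorem.
    ℙ-degree : ∀ n m → n ≡ m ℕ.+ i → ∀ (p : j ≤′ n) .(t<n : t < n) (j≤n : j ≤ n) (m≤ : m ≤ n ∸ j) x {d c} →
      d ≡ suc (x ℕ.+ e) → c ≡ x ℕ.+ e →
      ℙ (process k p) (λ G → degree G (fromℕ< t<n) ≟ d)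
        ≡ ι (c C x) * ∑[ u ≤ x ] (((ℤ.-1ℤ ℤ.^ u) ℤ.* + (x C u)) / 1 * quotient n m j≤n m≤ (y u))
    ℙ-degree n m refl p t<n j≤n m≤ x {d} refl refl = begin
      ℙ (process k p) (λ G → degree G (fromℕ< t<n) ≟ d)
        ≡⟨ ℙ≡𝔼 (process k p) (λ G → degree G (fromℕ< t<n) ≟ d) ⟩
      degreeLaw p (fromℕ< t<n) d
        ≡⟨ Law.agrees (degreeLaw-closed m m≤ p t<n j≤n) x ⟩
      closed e (λ u → quotient n m j≤n m≤ (y u)) x
        ≡⟨ cong (ι ((x ℕ.+ e) C x) *_) (∑≤-cong x λ u → cong (_* quotient n m j≤n m≤ (y u)) (/1≡signedC x u)) ⟨
      _ ∎

-- The two initial degrees, `j ∸ 1` and `k`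

mainTheorem1 : (k j : ℕ) (2≤k : 2 ≤ k) (k<j : k ℕ.+ 1 ≤ j) →
    ( (i n : ℕ) (1≤i : 1 ≤ i) (i≤j : i ≤ j) (j≤n : j ≤ n) (x : ℕ) → x ≤ n ∸ j →
    ℙ (process k (≤⇒≤′ j≤n)) (λ G → degree G (v i 1≤i (≤-trans i≤j j≤n)) ≟ (j ∸ 1) ℕ.+ x)
    ≡ ι ((x ℕ.+ j ∸ 2) C x) *
    ∑[ u ≤ x ] (((ℤ.-1ℤ ℤ.^ u) ℤ.* + (x C u)) / 1 *
    ([ ι n - ι j + (((+ j ℤ.- + 1) ℤ.* (+ j ℤ.- + k) ℤ.- + k ℤ.* + u) / (2 ℕ.* k)) {{2k≢0 2≤k}} - 1ℚ ]↓ (n ∸ j)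
    ÷ [ ι n - ι j + R k j 2≤k - 1ℚ ]↓ (n ∸ j)) {{denominator≢0 2≤k k<j j≤n ≤-refl}}) )
    ×
    ( (i n : ℕ) (j<i : j < i) (i≤n : i ≤ n) (x : ℕ) → x ≤ n ∸ i →
    ℙ (process k (≤⇒≤′ (≤-trans (<⇒≤ j<i) i≤n))) (λ G → degree G (v i (m<n⇒0<n j<i) i≤n) ≟ k ℕ.+ x)
    ≡ ι ((x ℕ.+ k ∸ 1) C x) *
    ∑[ u ≤ x ] (((ℤ.-1ℤ ℤ.^ u) ℤ.* + (x C u)) / 1 *
    ([ ι n - ι j + R k j 2≤k - + (u ℕ.+ k) / 2 - 1ℚ ]↓ (n ∸ i)
    ÷ [ ι n - ι j + R k j 2≤k - 1ℚ ]↓ (n ∸ i)) {{denominator≢0 2≤k k<j (≤-trans (<⇒≤ j<i) i≤n) (∸-monoʳ-≤ n (<⇒≤ j<i))}}) )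
mainTheorem1 (suc (suc l)) 1 (s≤s (s≤s _)) (s≤s ())
-- Writing j as e+2 makes the initial degree j-1 equal to `suc e` by computation.
mainTheorem1 (suc (suc l)) j@(suc (suc e)) 2≤k@(s≤s (s≤s _)) k<j = old , new
  where
  k : ℕ
  k = suc (suc l)
  open +-*-Solver
  open Process l j k<j (R k j 2≤k) (R-positive 2≤k k<j) (R-scaled k j 2≤k) (denominator≢0 2≤k k<j)

  old : (i n : ℕ) (1≤i : 1 ≤ i) (i≤j : i ≤ j) (j≤n : j ≤ n) (x : ℕ) → x ≤ n ∸ j →
    ℙ (process k (≤⇒≤′ j≤n)) (λ G → degree G (v i 1≤i (≤-trans i≤j j≤n)) ≟ (j ∸ 1) ℕ.+ x)
    ≡ ι ((x ℕ.+ j ∸ 2) C x) *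
    ∑[ u ≤ x ] (((ℤ.-1ℤ ℤ.^ u) ℤ.* + (x C u)) / 1 *
    ([ ι n - ι j + (((+ j ℤ.- + 1) ℤ.* (+ j ℤ.- + k) ℤ.- + k ℤ.* + u) / (2 ℕ.* k)) {{2k≢0 2≤k}} - 1ℚ ]↓ (n ∸ j)
    ÷ [ ι n - ι j + R k j 2≤k - 1ℚ ]↓ (n ∸ j)) {{denominator≢0 2≤k k<j j≤n ≤-refl}})
  old (suc t) n 1≤i t<j j≤n x _ =
    ℙ-degree e j t ≤-refl t<j y 2y≡ base n (n ∸ j) (sym (ℕ.m∸n+n≡m j≤n)) (≤⇒≤′ j≤n) (≤-trans t<j j≤n) j≤n ≤-refl x
      (cong suc (ℕ.+-comm e x)) (ℕ.+-∸-assoc x {j} {2} (s≤s (s≤s z≤n)))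
    where
    y : ℕ → ℚ
    y u = (((+ j ℤ.- + 1) ℤ.* (+ j ℤ.- + k) ℤ.- + k ℤ.* + u) / (2 ℕ.* k)) {{2k≢0 2≤k}}

    base : (p : j ≤′ j) → Almost (λ G → degree G (fromℕ< t<j) ≡ suc e) (process k p)
    base (ℕ.≤′-reflexive refl) = degree-complete (fromℕ< t<j) ∷ []
    base (≤′-step p)           = contradiction (ℕ.≤′⇒≤ p) (ℕ.<⇒≱ ≤-refl)

    -- Multiplied by k, this is (j-1)(j-k)-ku = j(j-1)-k(j-1+u).
    2y≡ : ∀ u → ι 2 * y u ≡ ι 2 * R k j 2≤k - ι (suc (u ℕ.+ e))
    2y≡ u = *-cancelʳ (ι k) (begin
      ι 2 * y u * ι k            ≡⟨ ring₁ (ι 2) (y u) (ι k) ⟩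
      y u * (ι 2 * ι k)          ≡⟨ cong (y u *_) (ι-* 2 k) ⟨
      y u * ι (2 ℕ.* k)
        ≡⟨ /-*-cancel ((+ j ℤ.- + 1) ℤ.* (+ j ℤ.- + k) ℤ.- + k ℤ.* + u) (2 ℕ.* k) {{2k≢0 2≤k}} ⟩
      fromℤ ((+ j ℤ.- + 1) ℤ.* (+ j ℤ.- + k) ℤ.- + k ℤ.* + u)
                                 ≡⟨ trans (fromℤ-- ((+ j ℤ.- + 1) ℤ.* (+ j ℤ.- + k)) (+ k ℤ.* + u)) (cong₂ _-_
                                      (trans (fromℤ-* (+ j ℤ.- + 1) (+ j ℤ.- + k)) (cong₂ _*_ (fromℤ-- (+ j) (+ 1))
                                        (fromℤ-- (+ j) (+ k))))
                                      (fromℤ-* (+ k) (+ u))) ⟩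
      (ι j - 1ℚ) * (ι j - ι k) - ι k * ι u
        ≡⟨ cong (λ z → (z - 1ℚ) * (z - ι k) - ι k * ι u) (ι-suc (suc e)) ⟩
      (1ℚ + ι (suc e) - 1ℚ) * (1ℚ + ι (suc e) - ι k) - ι k * ι u
        ≡⟨ ring₂ (ι (suc e)) (ι k) (ι u) ⟩
      (1ℚ + ι (suc e)) * ι (suc e) - (ι u + ι (suc e)) * ι k
        ≡⟨ cong₂ (λ y z → y - z * ι k)
             (trans (cong (_* ι (suc e)) (sym (ι-suc (suc e))))
               (trans (sym (ι-* j (suc e))) (sym (R-scaled k j 2≤k))))
             (trans (sym (ι-+ u (suc e))) (cong ι (ℕ.+-suc u e))) ⟩
      ι 2 * R k j 2≤k * ι k - ι (suc (u ℕ.+ e)) * ι k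
        ≡⟨ ring₃ (ι 2 * R k j 2≤k) (ι (suc (u ℕ.+ e))) (ι k) ⟩
      (ι 2 * R k j 2≤k - ι (suc (u ℕ.+ e))) * ι k ∎)
      where
      ring₁ : ∀ t y k → t * y * k ≡ y * (t * k)
      ring₁ = solve 3 (λ t y k → t :* y :* k := y :* (t :* k)) refl
      ring₂ : ∀ e k u → (1ℚ + e - 1ℚ) * (1ℚ + e - k) - k * u ≡ (1ℚ + e) * e - (u + e) * k
      ring₂ = solve 3 (λ e k u → (con 1ℚ :+ e :- con 1ℚ) :* (con 1ℚ :+ e :- k) :- k :* u
                        := (con 1ℚ :+ e) :* e :- (u :+ e) :* k) refl
      ring₃ : ∀ a b k → a * k - b * k ≡ (a - b) * k
      ring₃ = solve 3 (λ a b k → a :* k :- b :* k := (a :- b) :* k) refl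

  new : (i n : ℕ) (j<i : j < i) (i≤n : i ≤ n) (x : ℕ) → x ≤ n ∸ i →
    ℙ (process k (≤⇒≤′ (≤-trans (<⇒≤ j<i) i≤n))) (λ G → degree G (v i (m<n⇒0<n j<i) i≤n) ≟ k ℕ.+ x)
    ≡ ι ((x ℕ.+ k ∸ 1) C x) *
    ∑[ u ≤ x ] (((ℤ.-1ℤ ℤ.^ u) ℤ.* + (x C u)) / 1 *
    ([ ι n - ι j + R k j 2≤k - + (u ℕ.+ k) / 2 - 1ℚ ]↓ (n ∸ i)
    ÷ [ ι n - ι j + R k j 2≤k - 1ℚ ]↓ (n ∸ i)) {{denominator≢0 2≤k k<j (≤-trans (<⇒≤ j<i) i≤n) (∸-monoʳ-≤ n (<⇒≤ j<i))}})
  new (suc t) n j<i i≤n x _ = trans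
    (ℙ-degree (suc l) (suc t) t (<⇒≤ j<i) ≤-refl y 2y≡ base n (n ∸ suc t) (sym (ℕ.m∸n+n≡m i≤n))
      (≤⇒≤′ (≤-trans (<⇒≤ j<i) i≤n)) i≤n (≤-trans (<⇒≤ j<i) i≤n) (∸-monoʳ-≤ n (<⇒≤ j<i)) x
      (trans (cong (2 ℕ.+_) (ℕ.+-comm l x)) (cong (1 ℕ.+_) (sym (ℕ.+-suc x l)))) (ℕ.+-∸-assoc x {k} {1} (s≤s z≤n)))
    -- The theorem adds R before subtracting (u+k)/2, whereas `y` groups the two together.
    (cong (ι ((x ℕ.+ k ∸ 1) C x) *_) (∑≤-cong x λ u → cong (λ z → ((ℤ.-1ℤ ℤ.^ u) ℤ.* + (x C u)) / 1 *
        ([ z - 1ℚ ]↓ (n ∸ suc t)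
        ÷ [ ι n - ι j + R k j 2≤k - 1ℚ ]↓ (n ∸ suc t)) {{denominator≢0 2≤k k<j (≤-trans (<⇒≤ j<i) i≤n) (∸-monoʳ-≤ n (<⇒≤ j<i))}})
      (sym (ℚ.+-assoc (ι n - ι j) (R k j 2≤k) (- (+ (u ℕ.+ k) / 2))))))
    where
    y : ℕ → ℚ
    y u = R k j 2≤k - + (u ℕ.+ k) / 2

    base : (p : j ≤′ suc t) → Almost (λ G → degree G (fromℕ< (≤-refl {suc t})) ≡ k) (process k p)
    base ≤′-refl     = contradiction j<i (ℕ.<⇒≱ (s≤s ≤-refl))
    -- At time i the vertex in question is the one just added, so its degree is the size k of its
    -- attachment set in every outcome.
    base (≤′-step p) = Almost-bind (valid-process p) λ {G} valid →
      Almost-step l G (l<degree (ℕ.≤′⇒≤ p) valid) λ S ∣S∣≡k →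
        trans (cong (degree (addVertex G S)) (sym (Fin.fromℕ-def t))) (trans (degree-addVertex-new G S) ∣S∣≡k)

    2y≡ : ∀ u → ι 2 * y u ≡ ι 2 * R k j 2≤k - ι (suc (u ℕ.+ suc l))
    2y≡ u = begin
      ι 2 * (R k j 2≤k - + (u ℕ.+ k) / 2)
        ≡⟨ ring (ι 2) (R k j 2≤k) (+ (u ℕ.+ k) / 2) ⟩
      ι 2 * R k j 2≤k - + (u ℕ.+ k) / 2 * ι 2
        ≡⟨ cong (λ z → ι 2 * R k j 2≤k - z) (trans (/-*-cancel (+ (u ℕ.+ k)) 2) (cong ι (ℕ.+-suc u (suc l)))) ⟩
      ι 2 * R k j 2≤k - ι (suc (u ℕ.+ suc l)) ∎
      where
      ring : ∀ t r h → t * (r - h) ≡ t * r - h * t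
      ring = solve 3 (λ t r h → t :* (r :- h) := t :* r :- h :* t) refl
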